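{- For every $K_3N$ $n=pqr$, $$A<\sqrt3\,\sqrt[6]{n}-\frac{1}{2\sqrt[4]{12}}\sqrt[12]{n}.$$
   Context: A $K_3N$ (Korselt number with three factors) is an integer $n$ together with a factorisation $n=pqr$, where $1<p<q<r$ are odd integers (not necessarily prime) such that each of $p-1,\ q-1,\ r-1$ divides $n-1$, and such that $E:=\dfrac{pq-1}{r-1}$ (which is an integer by the divisibility condition) satisfies $E\ge 2$. Put $H:=\gcd(p-1,q-1,r-1)$ and $A:=\frac{p-1}{H}$. -}

module Defs where

open import Data.Nat.Base as ℕ using (ℕ; zero; suc)
import Data.Nat.Properties as ℕ
import Data.Nat.Solver as ℕSolver
open import Data.Nat.Divisibility using (_∣_; n∣m*n; ∣m+n∣m⇒∣n)
open import Data.Nat.DivMod using (m/n*n≡m)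
open import Data.Nat.GCD using (gcd; gcd[m,n]∣m; gcd[m,n]≢0)
open import Data.Integer.Base as ℤ using (+_; +[1+_]; -[1+_]; +<+; +≤+)
import Data.Integer.Properties as ℤ
open import Data.Rational.Base
open import Data.Rational.Properties
open import Data.Rational.Solver using (module +-*-Solver)
import Data.Rational.Unnormalised.Base as ℚᵘ
import Data.Rational.Unnormalised.Properties as ℚᵘ
open import Data.Product.Base using (Σ-syntax; ∃-syntax; _×_; _,_; proj₁; proj₂)
open import Data.Sum.Base using (inj₁; inj₂)
open import Relation.Nullary using (¬_; yes; no; contradiction)
open import Relation.Binary.PropositionalEquality
  using (_≡_; refl; sym; trans; cong; cong₂; subst; subst₂)

Cauchy : (ℕ → ℚ) → Set
Cauchy s = ∀ ε → 0ℚ < ε → ∃[ N ] (∀ m n → N ℕ.≤ m → N ℕ.≤ n → ∣ s m - s n ∣ < ε)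

record ℝ : Set where
  no-eta-equality
  constructor mkℝ
  field
    seq    : ℕ → ℚ
    cauchy : Cauchy seq

open ℝ public

infix 4 _<ᴿ_
_<ᴿ_ : ℝ → ℝ → Set
x <ᴿ y = ∃[ ε ] (0ℚ < ε × ∃[ N ] (∀ m → N ℕ.≤ m → seq x m + ε ≤ seq y m))

0<½* : ∀ {ε} → 0ℚ < ε → 0ℚ < ½ * ε
0<½* {ε} h = positive⁻¹ (½ * ε) {{pos*pos⇒pos ½ ε {{positive h}}}}

halves : ∀ ε → ½ * ε + ½ * ε ≡ ε
halves ε = trans (sym (*-distribʳ-+ ε ½ ½)) (*-identityˡ ε)

0<* : ∀ {a b} → 0ℚ < a → 0ℚ < b → 0ℚ < a * b
0<* {a} {b} ha hb = positive⁻¹ (a * b) {{pos*pos⇒pos a {{positive ha}} b {{positive hb}}}}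

quot : ∀ {B ε} → 0ℚ < B → 0ℚ < ε → ∃[ δ ] (0ℚ < δ × B * δ ≡ ε)
quot {B} {ε} hB hε = 1/ B * ε , 0<* (positive⁻¹ (1/ B) {{1/pos⇒pos B}}) hε
                   , trans (sym (*-assoc B (1/ B) ε)) (trans (cong (_* ε) (*-inverseʳ B)) (*-identityˡ ε))
  where instance
    posB : Positive B
    posB = positive hB
    nzB : NonZero B
    nzB = pos⇒nonZero B

mul-small : ∀ {u v B δ} → 0ℚ < B → ∣ u ∣ ≤ B → ∣ v ∣ < δ → ∣ u * v ∣ < B * δ
mul-small {u} {v} {B} {δ} hB hu hv = subst (_< B * δ) (sym (∣p*q∣≡∣p∣*∣q∣ u v))
  (≤-<-trans (*-monoʳ-≤-nonNeg ∣ v ∣ {{∣-∣-nonNeg v}} hu) (*-monoʳ-<-pos B {{positive hB}} hv))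

bounded : ∀ s → Cauchy s → ∃[ B ] (0ℚ < B × ∃[ N ] (∀ m → N ℕ.≤ m → ∣ s m ∣ ≤ B))
bounded s c with c 1ℚ (positive⁻¹ 1ℚ)
... | N , h = 1ℚ + ∣ s N ∣
            , positive⁻¹ (1ℚ + ∣ s N ∣) {{pos+nonNeg⇒pos 1ℚ ∣ s N ∣ {{∣-∣-nonNeg (s N)}}}}
            , N , λ m N≤m → begin
    ∣ s m ∣                   ≡⟨ cong ∣_∣ (rearrange (s m) (s N)) ⟩
    ∣ (s m - s N) + s N ∣     ≤⟨ ∣p+q∣≤∣p∣+∣q∣ (s m - s N) (s N) ⟩
    ∣ s m - s N ∣ + ∣ s N ∣   ≤⟨ +-monoˡ-≤ ∣ s N ∣ (<⇒≤ (h m N N≤m ℕ.≤-refl)) ⟩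
    1ℚ + ∣ s N ∣              ∎
  where
  open ≤-Reasoning
  rearrange : ∀ a b → a ≡ (a - b) + b
  rearrange = solve 2 (λ a b → a := (a :- b) :+ b) refl
    where open +-*-Solver

const-cauchy : ∀ q → Cauchy (λ _ → q)
const-cauchy q ε hε = 0 , λ _ _ _ _ → subst (_< ε) (sym (cong ∣_∣ (+-inverseʳ q))) hε

+-cauchy : ∀ s t → Cauchy s → Cauchy t → Cauchy (λ m → s m + t m)
+-cauchy s t cs ct ε hε with cs (½ * ε) (0<½* hε) | ct (½ * ε) (0<½* hε)
... | M , f | N , g = M ℕ.⊔ N , λ m n hm hn → begin-strict
    ∣ (s m + t m) - (s n + t n) ∣      ≡⟨ cong ∣_∣ (rearrange (s m) (t m) (s n) (t n)) ⟩
    ∣ (s m - s n) + (t m - t n) ∣      ≤⟨ ∣p+q∣≤∣p∣+∣q∣ (s m - s n) (t m - t n) ⟩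
    ∣ s m - s n ∣ + ∣ t m - t n ∣      <⟨ +-mono-< (f m n (ℕ.m⊔n≤o⇒m≤o M N hm) (ℕ.m⊔n≤o⇒m≤o M N hn))
                                                   (g m n (ℕ.m⊔n≤o⇒n≤o M N hm) (ℕ.m⊔n≤o⇒n≤o M N hn)) ⟩
    ½ * ε + ½ * ε                      ≡⟨ halves ε ⟩
    ε                                  ∎
  where
  open ≤-Reasoning
  rearrange : ∀ a b c d → (a + b) - (c + d) ≡ (a - c) + (b - d)
  rearrange = solve 4 (λ a b c d → (a :+ b) :- (c :+ d) := (a :- c) :+ (b :- d)) refl
    where open +-*-Solver

neg-cauchy : ∀ s → Cauchy s → Cauchy (λ m → - s m)
neg-cauchy s c ε hε with c ε hε
... | N , f = N , λ m n hm hn → subst (_< ε)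
    (trans (sym (∣-p∣≡∣p∣ (s m - s n))) (cong ∣_∣ (neg-distrib-+ (s m) (- s n)))) (f m n hm hn)

*-close : ∀ {a b c d B D β δ} → 0ℚ < B → 0ℚ < D → ∣ a ∣ ≤ B → ∣ d ∣ ≤ D →
          ∣ a - c ∣ < δ → ∣ b - d ∣ < β → ∣ a * b - c * d ∣ < B * β + D * δ
*-close {a} {b} {c} {d} {B} {D} {β} {δ} hB hD ha hd hac hbd = begin-strict
    ∣ a * b - c * d ∣                  ≡⟨ cong ∣_∣ (rearrange a b c d) ⟩
    ∣ a * (b - d) + d * (a - c) ∣      ≤⟨ ∣p+q∣≤∣p∣+∣q∣ (a * (b - d)) (d * (a - c)) ⟩
    ∣ a * (b - d) ∣ + ∣ d * (a - c) ∣  <⟨ +-mono-< (mul-small {a} {b - d} hB ha hbd)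
                                                   (mul-small {d} {a - c} hD hd hac) ⟩
    B * β + D * δ                      ∎
  where
  open ≤-Reasoning
  rearrange : ∀ a b c d → a * b - c * d ≡ a * (b - d) + d * (a - c)
  rearrange = solve 4 (λ a b c d → a :* b :- c :* d := a :* (b :- d) :+ d :* (a :- c)) refl
    where open +-*-Solver

*-cauchy : ∀ s t → Cauchy s → Cauchy t → Cauchy (λ m → s m * t m)
*-cauchy s t cs ct ε hε =
  let B , hB , M₁ , bs = bounded s cs
      D , hD , M₂ , bt = bounded t ct
      β , hβ , Bβ = quot hB (0<½* hε)
      δ , hδ , Dδ = quot hD (0<½* hε)
      N₁ , f = cs δ hδ
      N₂ , g = ct β hβ
      M = M₁ ℕ.⊔ M₂
      N = N₁ ℕ.⊔ N₂
  in M ℕ.⊔ N , λ m n hm hn →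
      let mN = ℕ.m⊔n≤o⇒n≤o M N hm
          nN = ℕ.m⊔n≤o⇒n≤o M N hn
      in subst (∣ s m * t m - s n * t n ∣ <_) (trans (cong₂ _+_ Bβ Dδ) (halves ε))
           (*-close {s m} {t m} {s n} {t n} {B} {D} {β} {δ} hB hD
             (bs m (ℕ.m⊔n≤o⇒m≤o M₁ M₂ (ℕ.m⊔n≤o⇒m≤o M N hm)))
             (bt n (ℕ.m⊔n≤o⇒n≤o M₁ M₂ (ℕ.m⊔n≤o⇒m≤o M N hn)))
             (f m n (ℕ.m⊔n≤o⇒m≤o N₁ N₂ mN) (ℕ.m⊔n≤o⇒m≤o N₁ N₂ nN))
             (g m n (ℕ.m⊔n≤o⇒n≤o N₁ N₂ mN) (ℕ.m⊔n≤o⇒n≤o N₁ N₂ nN)))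

fromℕ : ℕ → ℝ
fromℕ n = mkℝ (λ _ → + n / 1) (const-cauchy (+ n / 1))

infixl 6 _+ᴿ_ _-ᴿ_
infixl 7 _*ᴿ_ _/ᴿ_[_]
infix  8 -ᴿ_

_+ᴿ_ : ℝ → ℝ → ℝ
x +ᴿ y = mkℝ (λ m → seq x m + seq y m) (+-cauchy (seq x) (seq y) (cauchy x) (cauchy y))

-ᴿ_ : ℝ → ℝ
-ᴿ x = mkℝ (λ m → - seq x m) (neg-cauchy (seq x) (cauchy x))

_-ᴿ_ : ℝ → ℝ → ℝ
x -ᴿ y = x +ᴿ (-ᴿ y)

_*ᴿ_ : ℝ → ℝ → ℝ
x *ᴿ y = mkℝ (λ m → seq x m * seq y m) (*-cauchy (seq x) (seq y) (cauchy x) (cauchy y))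

-- Junk value inv 0 = 0: a positive real may have finitely many zero terms.
inv : ℚ → ℚ
inv q with q ≟ 0ℚ
... | yes _  = 0ℚ
... | no q≢0 = (1/ q) {{≢-nonZero q≢0}}

*-inv : ∀ {q} → 0ℚ < q → q * inv q ≡ 1ℚ
*-inv {q} 0<q with q ≟ 0ℚ
... | yes q≡0 = contradiction (sym q≡0) (<⇒≢ 0<q)
... | no q≢0  = *-inverseʳ q {{≢-nonZero q≢0}}

0<inv : ∀ {q} → 0ℚ < q → 0ℚ < inv q
0<inv {q} 0<q with q ≟ 0ℚ
... | yes q≡0 = contradiction (sym q≡0) (<⇒≢ 0<q)
... | no q≢0  = positive⁻¹ ((1/ q) {{≢-nonZero q≢0}}) {{1/pos⇒pos q {{positive 0<q}}}}

inv-close : ∀ {e ε a b} → 0ℚ < e → e ≤ a → e ≤ b → 0ℚ < ε →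
            ∣ a - b ∣ < (e * e) * ε → ∣ inv a - inv b ∣ < ε
inv-close {e} {ε} {a} {b} 0<e e≤a e≤b 0<ε h = begin-strict
    ∣ i - j ∣                    ≡⟨ cong ∣_∣ i-j ⟩
    ∣ (i * j) * (- (a - b)) ∣    ≡⟨ ∣p*q∣≡∣p∣*∣q∣ (i * j) (- (a - b)) ⟩
    ∣ i * j ∣ * ∣ - (a - b) ∣    ≡⟨ cong₂ _*_ (0≤p⇒∣p∣≡p (<⇒≤ 0<ij)) (∣-p∣≡∣p∣ (a - b)) ⟩
    (i * j) * ∣ a - b ∣          <⟨ *-monoʳ-<-pos (i * j) {{positive 0<ij}} h ⟩
    (i * j) * ((e * e) * ε)      ≡⟨ shuffle i j e ε ⟩
    (e * i) * ((e * j) * ε)      ≤⟨ *-monoʳ-≤-nonNeg ((e * j) * ε) {{nonNegative (<⇒≤ (0<* (0<* 0<e 0<j) 0<ε))}}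
                                      (ei≤1 0<a e≤a) ⟩
    1ℚ * ((e * j) * ε)           ≡⟨ *-identityˡ ((e * j) * ε) ⟩
    (e * j) * ε                  ≤⟨ *-monoʳ-≤-nonNeg ε {{nonNegative (<⇒≤ 0<ε)}} (ei≤1 0<b e≤b) ⟩
    1ℚ * ε                       ≡⟨ *-identityˡ ε ⟩
    ε                            ∎
  where
  open ≤-Reasoning
  i = inv a
  j = inv b
  0<a = <-≤-trans 0<e e≤a
  0<b = <-≤-trans 0<e e≤b
  0<i = 0<inv 0<a
  0<j = 0<inv 0<b
  0<ij = 0<* 0<i 0<j
  ei≤1 : ∀ {c} → 0ℚ < c → e ≤ c → e * inv c ≤ 1ℚ
  ei≤1 {c} 0<c e≤c = ≤-trans (*-monoʳ-≤-nonNeg (inv c) {{nonNegative (<⇒≤ (0<inv 0<c))}} e≤c)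
                             (≤-reflexive (*-inv 0<c))
  shuffle : ∀ i j e ε → (i * j) * ((e * e) * ε) ≡ (e * i) * ((e * j) * ε)
  shuffle = solve 4 (λ i j e ε → (i :* j) :* ((e :* e) :* ε) := (e :* i) :* ((e :* j) :* ε)) refl
    where open +-*-Solver
  expand : ∀ a b i j → (b * j) * i - (a * i) * j ≡ (i * j) * (- (a - b))
  expand = solve 4 (λ a b i j → (b :* j) :* i :- (a :* i) :* j := (i :* j) :* (:- (a :- b))) refl
    where open +-*-Solver
  i-j : i - j ≡ (i * j) * (- (a - b))
  i-j = trans (cong₂ _-_ (sym (trans (cong (_* i) (*-inv 0<b)) (*-identityˡ i)))
                         (sym (trans (cong (_* j) (*-inv 0<a)) (*-identityˡ j))))
              (expand a b i j)

inv-cauchy : ∀ x → fromℕ 0 <ᴿ x → Cauchy (λ m → inv (seq x m))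
inv-cauchy x (e , 0<e , M , low) ε 0<ε with cauchy x ((e * e) * ε) (0<* (0<* 0<e 0<e) 0<ε)
... | N , f = M ℕ.⊔ N , λ m n hm hn →
  inv-close 0<e (low' m (ℕ.m⊔n≤o⇒m≤o M N hm)) (low' n (ℕ.m⊔n≤o⇒m≤o M N hn)) 0<ε
    (f m n (ℕ.m⊔n≤o⇒n≤o M N hm) (ℕ.m⊔n≤o⇒n≤o M N hn))
  where
  low' : ∀ m → M ℕ.≤ m → e ≤ seq x m
  low' m hm = subst (_≤ seq x m) (+-identityˡ e) (low m hm)

_/ᴿ_[_] : ∀ (x y : ℝ) → fromℕ 0 <ᴿ y → ℝ
x /ᴿ y [ 0<y ] = x *ᴿ mkℝ (λ m → inv (seq y m)) (inv-cauchy y 0<y)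

*ᴿ-pos : ∀ x y → fromℕ 0 <ᴿ x → fromℕ 0 <ᴿ y → fromℕ 0 <ᴿ x *ᴿ y
*ᴿ-pos x y (d , 0<d , M , f) (e , 0<e , N , g) = d * e , 0<* 0<d 0<e , M ℕ.⊔ N , λ m hm →
  let d≤x = subst (_≤ seq x m) (+-identityˡ d) (f m (ℕ.m⊔n≤o⇒m≤o M N hm))
      e≤y = subst (_≤ seq y m) (+-identityˡ e) (g m (ℕ.m⊔n≤o⇒n≤o M N hm))
  in begin
  0ℚ + d * e         ≡⟨ +-identityˡ (d * e) ⟩
  d * e              ≤⟨ *-monoʳ-≤-nonNeg e {{nonNegative (<⇒≤ 0<e)}} d≤x ⟩
  seq x m * e        ≤⟨ *-monoˡ-≤-nonNeg (seq x m) {{nonNegative (≤-trans (<⇒≤ 0<d) d≤x)}} e≤y ⟩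
  seq x m * seq y m  ∎
  where open ≤-Reasoning

-- ⌊ ᵏ√N ⌋
iroot : ℕ → ℕ → ℕ
iroot k zero = 0
iroot k (suc N) with suc (iroot k N) ℕ.^ k ℕ.≤? suc N
... | yes _ = suc (iroot k N)
... | no  _ = iroot k N

^-cancelˡ-< : ∀ k {a b} → a ℕ.^ k ℕ.< b ℕ.^ k → a ℕ.< b
^-cancelˡ-< k h = ℕ.≰⇒> λ b≤a → ℕ.<⇒≱ h (ℕ.^-monoˡ-≤ k b≤a)

iroot-spec : ∀ k .{{_ : ℕ.NonZero k}} N →
             iroot k N ℕ.^ k ℕ.≤ N × N ℕ.< suc (iroot k N) ℕ.^ k
iroot-spec (suc k) zero = ℕ.z≤n , ℕ.≤-reflexive (sym (ℕ.^-zeroˡ (suc k)))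
iroot-spec (suc k) (suc N) with suc (iroot (suc k) N) ℕ.^ suc k ℕ.≤? suc N | iroot-spec (suc k) N
... | yes h | _ , N< = h , ℕ.≤-<-trans N< (ℕ.^-monoˡ-< (suc k) ℕ.≤-refl)
... | no ¬h | ≤N , _ = ℕ.m≤n⇒m≤1+n ≤N , ℕ.≰⇒> ¬h

-- The m-th approximation a/(m+1), with a = ⌊ᵏ√(n (m+1)ᵏ)⌋, of the
-- non-negative k-th root of n satisfies  (a/(m+1))ᵏ ≤ n < ((a+1)/(m+1))ᵏ.
rootNum : ℕ → ℕ → ℕ → ℕ
rootNum k n m = iroot k (n ℕ.* suc m ℕ.^ k)

^-distribʳ-* : ∀ k a b → (a ℕ.* b) ℕ.^ k ≡ a ℕ.^ k ℕ.* b ℕ.^ k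
^-distribʳ-* zero    a b = refl
^-distribʳ-* (suc k) a b = trans (cong (a ℕ.* b ℕ.*_) (^-distribʳ-* k a b))
                                 (shuffle a b (a ℕ.^ k) (b ℕ.^ k))
  where
  shuffle : ∀ a b x y → a ℕ.* b ℕ.* (x ℕ.* y) ≡ a ℕ.* x ℕ.* (b ℕ.* y)
  shuffle = solve 4 (λ a b x y → a :* b :* (x :* y) := a :* x :* (b :* y)) refl
    where open ℕSolver.+-*-Solver

root-cross : ∀ k .{{_ : ℕ.NonZero k}} n i j →
             rootNum k n i ℕ.* suc j ℕ.< suc (rootNum k n j) ℕ.* suc i
root-cross k n i j = ^-cancelˡ-< k (begin-strict
    (a ℕ.* suc j) ℕ.^ k                   ≡⟨ ^-distribʳ-* k a (suc j) ⟩
    a ℕ.^ k ℕ.* J                         ≤⟨ ℕ.*-monoˡ-≤ J (proj₁ (iroot-spec k (n ℕ.* I))) ⟩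
    n ℕ.* I ℕ.* J                         ≡⟨ swap n I J ⟩
    n ℕ.* J ℕ.* I                         <⟨ ℕ.*-monoˡ-< I {{ℕ.m^n≢0 (suc i) k}} (proj₂ (iroot-spec k (n ℕ.* J))) ⟩
    suc b ℕ.^ k ℕ.* I                     ≡⟨ sym (^-distribʳ-* k (suc b) (suc i)) ⟩
    (suc b ℕ.* suc i) ℕ.^ k               ∎)
  where
  open ℕ.≤-Reasoning
  I = suc i ℕ.^ k
  J = suc j ℕ.^ k
  a = rootNum k n i
  b = rootNum k n j
  swap : ∀ x y z → x ℕ.* y ℕ.* z ≡ x ℕ.* z ℕ.* y
  swap = solve 3 (λ x y z → x :* y :* z := x :* z :* y) refl
    where open ℕSolver.+-*-Solver

/-≃ : ∀ a d → toℚᵘ (+ a / suc d) ℚᵘ.≃ ℚᵘ.mkℚᵘ (+ a) d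
/-≃ a d = toℚᵘ-fromℚᵘ (ℚᵘ.mkℚᵘ (+ a) d)

cross-< : ∀ a c i j → a ℕ.* suc j ℕ.< c ℕ.* suc i → + a / suc i < + c / suc j
cross-< a c i j h = toℚᵘ-cancel-<
  (ℚᵘ.<-respˡ-≃ (ℚᵘ.≃-sym (/-≃ a i)) (ℚᵘ.<-respʳ-≃ (ℚᵘ.≃-sym (/-≃ c j))
    (ℚᵘ.*<* (subst₂ ℤ._<_ (ℤ.pos-* a (suc j)) (ℤ.pos-* c (suc i)) (+<+ h)))))

cross-≤ : ∀ a c i j → a ℕ.* suc j ℕ.≤ c ℕ.* suc i → + a / suc i ≤ + c / suc j
cross-≤ a c i j h = toℚᵘ-cancel-≤
  (ℚᵘ.≤-respˡ-≃ (ℚᵘ.≃-sym (/-≃ a i)) (ℚᵘ.≤-respʳ-≃ (ℚᵘ.≃-sym (/-≃ c j))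
    (ℚᵘ.*≤* (subst₂ ℤ._≤_ (ℤ.pos-* a (suc j)) (ℤ.pos-* c (suc i)) (+≤+ h)))))

/-suc : ∀ a d → + suc a / suc d ≡ + a / suc d + + 1 / suc d
/-suc a d = toℚᵘ-injective (ℚᵘ.≃-trans (/-≃ (suc a) d) (ℚᵘ.≃-sym
  (ℚᵘ.≃-trans (toℚᵘ-homo-+ (+ a / suc d) (+ 1 / suc d))
  (ℚᵘ.≃-trans (ℚᵘ.+-cong (/-≃ a d) (/-≃ 1 d))
    (ℚᵘ.*≡* (trans (cong₂ ℤ._*_ numer refl)
              (trans (sym (ℤ.pos-* (a ℕ.* suc d ℕ.+ 1 ℕ.* suc d) (suc d)))
              (trans (cong +_ (lem a (suc d))) (ℤ.pos-* (suc a) (suc d ℕ.* suc d))))))))))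
  where
  numer : + a ℤ.* + suc d ℤ.+ + 1 ℤ.* + suc d
          ≡ + (a ℕ.* suc d ℕ.+ 1 ℕ.* suc d)
  numer = trans (cong₂ ℤ._+_ (sym (ℤ.pos-* a (suc d))) (sym (ℤ.pos-* 1 (suc d))))
                (sym (ℤ.pos-+ (a ℕ.* suc d) (1 ℕ.* suc d)))
  lem : ∀ a d → (a ℕ.* d ℕ.+ 1 ℕ.* d) ℕ.* d ≡ suc a ℕ.* (d ℕ.* d)
  lem = solve 2 (λ a d → (a :* d :+ con 1 :* d) :* d := (con 1 :+ a) :* (d :* d)) refl
    where open ℕSolver.+-*-Solver

archimedean : ∀ ε → 0ℚ < ε → ∃[ N ] (∀ m → N ℕ.≤ m → + 1 / suc m < ε)
archimedean (mkℚ (+ zero) d c) 0<ε = contradiction (drop-*<* 0<ε) λ { (+<+ ()) }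
archimedean (mkℚ -[1+ a ] d c) 0<ε = contradiction (drop-*<* 0<ε) λ ()
archimedean (mkℚ +[1+ a ] d c) 0<ε = suc d , λ m d<m → toℚᵘ-cancel-<
  (ℚᵘ.<-respˡ-≃ (ℚᵘ.≃-sym (/-≃ 1 m)) (ℚᵘ.*<* (subst₂ ℤ._<_ (ℤ.pos-* 1 (suc d)) (ℤ.pos-* (suc a) (suc m))
    (+<+ (ℕ.<-≤-trans (subst (ℕ._< suc m) (sym (ℕ.*-identityˡ (suc d))) (ℕ.s≤s d<m))
                      (ℕ.m≤n*m (suc m) (suc a)))))))

+-cancel-diff : ∀ b ε → (b + ε) - b ≡ ε
+-cancel-diff = solve 2 (λ b ε → (b :+ ε) :- b := ε) refl
  where open +-*-Solver
neg-diff : ∀ a b → - (a - b) ≡ b - a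
neg-diff = solve 2 (λ a b → :- (a :- b) := b :- a) refl
  where open +-*-Solver

∣-∣<-intro : ∀ {a b ε} → a < b + ε → b < a + ε → ∣ a - b ∣ < ε
∣-∣<-intro {a} {b} {ε} h₁ h₂ with ∣p∣≡p∨∣p∣≡-p (a - b)
... | inj₁ eq = subst (_< ε) (sym eq) (subst (a - b <_) (+-cancel-diff b ε) (+-monoˡ-< (- b) h₁))
... | inj₂ eq = subst (_< ε) (sym (trans eq (neg-diff a b)))
                  (subst (b - a <_) (+-cancel-diff a ε) (+-monoˡ-< (- a) h₂))

root : ∀ k .{{_ : ℕ.NonZero k}} → ℕ → ℝ
root k n = mkℝ s s-cauchy
  where
  s : ℕ → ℚ
  s m = + rootNum k n m / suc m
  close : ∀ i j → s i < s j + + 1 / suc j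
  close i j = subst (s i <_) (/-suc (rootNum k n j) j)
                (cross-< (rootNum k n i) (suc (rootNum k n j)) i j (root-cross k n i j))
  s-cauchy : Cauchy s
  s-cauchy ε 0<ε with archimedean ε 0<ε
  ... | N , small = N , λ i j hi hj →
    ∣-∣<-intro (<-trans (close i j) (+-monoʳ-< (s j) (small j hj)))
               (<-trans (close j i) (+-monoʳ-< (s i) (small i hi)))

root-pos : ∀ k .{{_ : ℕ.NonZero k}} n .{{_ : ℕ.NonZero n}} → fromℕ 0 <ᴿ root k n
root-pos k n = 1ℚ , positive⁻¹ 1ℚ , 0 , λ m _ →
  subst (_≤ seq (root k n) m) (sym (+-identityˡ 1ℚ)) (cross-≤ 1 (rootNum k n m) 0 m (bound m))
  where
  bound : ∀ m → 1 ℕ.* suc m ℕ.≤ rootNum k n m ℕ.* 1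
  bound m = subst₂ ℕ._≤_ (sym (ℕ.*-identityˡ (suc m))) (sym (ℕ.*-identityʳ (rootNum k n m)))
    (ℕ.s≤s⁻¹ (^-cancelˡ-< k (ℕ.≤-<-trans (ℕ.m≤n*m (suc m ℕ.^ k) n)
                               (proj₂ (iroot-spec k (n ℕ.* suc m ℕ.^ k))))))

0<2*⁴√12 : fromℕ 0 <ᴿ fromℕ 2 *ᴿ root 4 12
0<2*⁴√12 = *ᴿ-pos (fromℕ 2) (root 4 12)
  (1ℚ , positive⁻¹ 1ℚ , 0 , λ _ _ → cross-≤ 1 2 0 0 (ℕ.s≤s ℕ.z≤n)) (root-pos 4 12)

-- Since 1 < p < q < r, truncated subtraction is ordinary subtraction throughout.
record K₃N (n : ℕ) : Set where
  field
    p q r   : ℕ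
    n≡pqr   : n ≡ p ℕ.* q ℕ.* r
    1<p     : 1 ℕ.< p
    p<q     : p ℕ.< q
    q<r     : q ℕ.< r
    p-odd   : ¬ 2 ∣ p
    q-odd   : ¬ 2 ∣ q
    r-odd   : ¬ 2 ∣ r
    p-1∣n-1 : p ℕ.∸ 1 ∣ n ℕ.∸ 1
    q-1∣n-1 : q ℕ.∸ 1 ∣ n ℕ.∸ 1
    r-1∣n-1 : r ℕ.∸ 1 ∣ n ℕ.∸ 1

  instance
    p-1≢0 : ℕ.NonZero (p ℕ.∸ 1)
    p-1≢0 = ℕ.>-nonZero (ℕ.m<n⇒0<n∸m 1<p)

    r-1≢0 : ℕ.NonZero (r ℕ.∸ 1)
    r-1≢0 = ℕ.>-nonZero (ℕ.m<n⇒0<n∸m (ℕ.<-trans 1<p (ℕ.<-trans p<q q<r)))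

  E : ℕ
  E = (p ℕ.* q ℕ.∸ 1) ℕ./ (r ℕ.∸ 1)

  field
    2≤E : 2 ℕ.≤ E

  H : ℕ
  H = gcd (p ℕ.∸ 1) (gcd (q ℕ.∸ 1) (r ℕ.∸ 1))

  instance
    H≢0 : ℕ.NonZero H
    H≢0 = ℕ.≢-nonZero (gcd[m,n]≢0 (p ℕ.∸ 1) (gcd (q ℕ.∸ 1) (r ℕ.∸ 1))
                         (inj₁ (ℕ.≢-nonZero⁻¹ (p ℕ.∸ 1))))

  A : ℕ
  A = (p ℕ.∸ 1) ℕ./ H

  -- The two divisions above are exact.
  E-exact : E ℕ.* (r ℕ.∸ 1) ≡ p ℕ.* q ℕ.∸ 1
  E-exact = m/n*n≡m (∣m+n∣m⇒∣n {m = (p ℕ.* q) ℕ.* (r ℕ.∸ 1)} (subst (r ℕ.∸ 1 ∣_) n-1 r-1∣n-1) (n∣m*n (p ℕ.* q)))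
    where
    1≤r : 1 ℕ.≤ r
    1≤r = ℕ.<⇒≤ (ℕ.<-trans 1<p (ℕ.<-trans p<q q<r))
    1≤pq : 1 ℕ.≤ p ℕ.* q
    1≤pq = ℕ.*-mono-≤ (ℕ.<⇒≤ 1<p) (ℕ.<⇒≤ (ℕ.<-trans 1<p p<q))
    n-1 : n ℕ.∸ 1 ≡ (p ℕ.* q) ℕ.* (r ℕ.∸ 1) ℕ.+ (p ℕ.* q ℕ.∸ 1)
    n-1 = trans (cong (ℕ._∸ 1) (trans n≡pqr
            (trans (cong (p ℕ.* q ℕ.*_) (sym (ℕ.m∸n+n≡m 1≤r)))
            (trans (ℕ.*-distribˡ-+ (p ℕ.* q) (r ℕ.∸ 1) 1)
                   (cong (p ℕ.* q ℕ.* (r ℕ.∸ 1) ℕ.+_) (ℕ.*-identityʳ (p ℕ.* q)))))))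
            (ℕ.+-∸-assoc (p ℕ.* q ℕ.* (r ℕ.∸ 1)) 1≤pq)

  A-exact : A ℕ.* H ≡ p ℕ.∸ 1
  A-exact = m/n*n≡m (gcd[m,n]∣m (p ℕ.∸ 1) (gcd (q ℕ.∸ 1) (r ℕ.∸ 1)))

{-# OPTIONS --safe #-}
module Submission where

-- Write p - 1 = A h, q - 1 = B h, r - 1 = C h with h = H. The divisibility conditions make
-- A, B, C pairwise coprime divisors of h e₂ + e₁, where e₁, e₂, e₃ are the elementary symmetric
-- functions of A, B, C; hence k e₃ = h e₂ + e₁ for some k ≥ 1, and then n e₂³ ≥ k³ e₃⁴.
-- If 3 e₃ ≥ (A + w) e₂, i.e. if the harmonic mean of A, B, C is at least A + w, this gives
-- 27 n ≥ k³ (A + w)⁶.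
--
-- With G = √3 n^(1/6) the claim reads A < G - √(G / 24). It follows from 27 n ≥ (A + w)⁶ for any
-- w with 24 w² > A + w, because G ≥ A + w and √(G / 24) ≤ (G / (24 w) + w) / 2.
--
-- For k ≥ 2 take w = 2A / 5, since (7/5)⁶ < 8. For k = 1 the positive number e₁ - 9 h is an
-- integer, which forces 3 A ≤ 2 v² + 27 for v = C - A; so C is about √A away from A, and
-- w = v / 4 (or w = A / 8 when v > A / 2) is large enough unless A ≤ 15.

open import Defs
open import Data.Nat.Base as ℕ using (ℕ; zero; suc)
import Data.Nat.Properties as ℕ
open import Data.Product.Base using (∃-syntax; _×_; _,_; proj₁; proj₂)
open import Relation.Nullary using (yes; no; contradiction)
open import Relation.Binary.PropositionalEquality

module NaturalEstimates where

  open import Data.Nat.Base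
  open import Data.Nat.Properties
  open import Data.Nat.Divisibility
  open import Data.Nat.DivMod using (m/n*n≡m)
  open import Data.Nat.GCD using (gcd; gcd[m,n]∣m; gcd[m,n]∣n; gcd-greatest)
  open import Data.Nat.Coprimality as Coprime using (Coprime; coprime-divisor)
  open import Data.Nat.Solver using (module +-*-Solver)
  open +-*-Solver
  open ≤-Reasoning

  -- Elementary symmetric functions and the harmonic mean.

  e₁ e₂ e₃ : ℕ → ℕ → ℕ → ℕ
  e₁ A B C = A + B + C
  e₂ A B C = A * B + B * C + C * A
  e₃ A B C = A * B * C

  :e₁ :e₂ :e₃ : ∀ {n} (A B C : Polynomial n) → Polynomial n
  :e₁ A B C = A :+ B :+ C
  :e₂ A B C = A :* B :+ B :* C :+ C :* A
  :e₃ A B C = A :* B :* C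

  -- M e₂ ≤ N e₃ bounds the harmonic mean of A, B, C from below by 3 M / N.
  harmonic-mono : ∀ M N A {B₀ C₀ B C} .{{_ : NonZero B₀}} .{{_ : NonZero C₀}} → B₀ ≤ B → C₀ ≤ C →
                  M * e₂ A B₀ C₀ ≤ N * e₃ A B₀ C₀ → M * e₂ A B C ≤ N * e₃ A B C
  harmonic-mono M N A {B₀} {C₀} {B} {C} B₀≤B C₀≤C h = *-cancelʳ-≤ _ _ (B₀ * C₀) {{m*n≢0 B₀ C₀}} (begin
    M * e₂ A B C * (B₀ * C₀)                        ≡⟨ split M A B C B₀ C₀ ⟩
    M * (A * B * B₀ * C₀ + B * C * B₀ * C₀ + A * C * C₀ * B₀)
      ≤⟨ *-monoʳ-≤ M (+-mono-≤ (+-monoˡ-≤ (B * C * B₀ * C₀) (*-monoʳ-≤ (A * B * B₀) C₀≤C))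
                               (*-monoʳ-≤ (A * C * C₀) B₀≤B)) ⟩
    M * (A * B * B₀ * C + B * C * B₀ * C₀ + A * C * C₀ * B)  ≡⟨ merge M A B C B₀ C₀ ⟩
    M * e₂ A B₀ C₀ * (B * C)                        ≤⟨ *-monoˡ-≤ (B * C) h ⟩
    N * e₃ A B₀ C₀ * (B * C)                        ≡⟨ swap N A B C B₀ C₀ ⟩
    N * e₃ A B C * (B₀ * C₀)                        ∎)
    where
    split : ∀ M A B C B₀ C₀ → M * e₂ A B C * (B₀ * C₀) ≡
            M * (A * B * B₀ * C₀ + B * C * B₀ * C₀ + A * C * C₀ * B₀)
    split = solve 6 (λ M A B C B₀ C₀ → M :* :e₂ A B C :* (B₀ :* C₀) :=
            M :* (A :* B :* B₀ :* C₀ :+ B :* C :* B₀ :* C₀ :+ A :* C :* C₀ :* B₀)) refl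
    merge : ∀ M A B C B₀ C₀ → M * (A * B * B₀ * C + B * C * B₀ * C₀ + A * C * C₀ * B) ≡
            M * e₂ A B₀ C₀ * (B * C)
    merge = solve 6 (λ M A B C B₀ C₀ → M :* (A :* B :* B₀ :* C :+ B :* C :* B₀ :* C₀ :+ A :* C :* C₀ :* B) :=
            M :* :e₂ A B₀ C₀ :* (B :* C)) refl
    swap : ∀ N A B C B₀ C₀ → N * e₃ A B₀ C₀ * (B * C) ≡ N * e₃ A B C * (B₀ * C₀)
    swap = solve 6 (λ N A B C B₀ C₀ → N :* :e₃ A B₀ C₀ :* (B :* C) := N :* :e₃ A B C :* (B₀ :* C₀)) refl

  -- Inequalities for one triple, parametrised by its gaps.

  module Triple (A a b : ℕ) .{{_ : NonZero A}} where

    -- `R`, `Θ` and `Δ` are the defects in `e₁ e₂ ≥ 9 e₃`, `e₂² ≥ 3 e₁ e₃` and `e₁² ≥ 3 e₂`. Written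
    -- through the gaps `a` and `b` they avoid truncated subtraction. `Θ` is the analogue of `Δ` for
    -- the products AB ≤ CA ≤ BC, whose gaps are `A * b` and `C * a`.
    B C v S₁ S₂ S₃ R Δ Θ : ℕ
    B  = A + a
    C  = A + a + b
    v  = a + b
    S₁ = e₁ A B C
    S₂ = e₂ A B C
    S₃ = e₃ A B C
    R  = A * b ^ 2 + B * v ^ 2 + C * a ^ 2
    Δ  = a ^ 2 + a * b + b ^ 2
    Θ  = (C * a) ^ 2 + (C * a) * (A * b) + (A * b) ^ 2

    1≤A : 1 ≤ A
    1≤A = >-nonZero⁻¹ A

    A≤B : A ≤ B
    A≤B = m≤m+n A a

    B≤C : B ≤ C
    B≤C = m≤m+n B b

    A≤C : A ≤ C
    A≤C = ≤-trans A≤B B≤C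

    instance
      B≢0 : NonZero B
      B≢0 = >-nonZero (≤-trans 1≤A A≤B)
      C≢0 : NonZero C
      C≢0 = >-nonZero (≤-trans 1≤A A≤C)
      S₂≢0 : NonZero S₂
      S₂≢0 = >-nonZero (≤-trans (*-mono-≤ (≤-trans 1≤A A≤C) 1≤A) (m≤n+m (C * A) (A * B + B * C)))

    S₁S₂≡ : S₁ * S₂ ≡ 9 * S₃ + R
    S₁S₂≡ = solve 3 (λ A a b → let B = A :+ a; C = A :+ a :+ b; v = a :+ b in
      :e₁ A B C :* :e₂ A B C := con 9 :* :e₃ A B C :+ (A :* b :^ 2 :+ B :* v :^ 2 :+ C :* a :^ 2)) refl A a b

    S₂²≡ : S₂ * S₂ ≡ 3 * S₁ * S₃ + Θ
    S₂²≡ = solve 3 (λ A a b → let B = A :+ a; C = A :+ a :+ b in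
      :e₂ A B C :* :e₂ A B C := con 3 :* :e₁ A B C :* :e₃ A B C :+
        ((C :* a) :^ 2 :+ (C :* a) :* (A :* b) :+ (A :* b) :^ 2)) refl A a b

    S₁²≡ : S₁ * S₁ ≡ 3 * S₂ + Δ
    S₁²≡ = solve 3 (λ A a b → let B = A :+ a; C = A :+ a :+ b in
      :e₁ A B C :* :e₁ A B C := con 3 :* :e₂ A B C :+ (a :^ 2 :+ a :* b :+ b :^ 2)) refl A a b

    -- Equality holds for the triple A, A, A, and raising two entries can only raise the harmonic
    -- mean.
    AS₂≤3S₃ : A * S₂ ≤ 3 * S₃
    AS₂≤3S₃ = harmonic-mono A 3 A A≤B A≤C (≤-reflexive
      (solve 1 (λ A → A :* :e₂ A A A := con 3 :* :e₃ A A A) refl A))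

    S₂≤3S₃ : S₂ ≤ 3 * S₃
    S₂≤3S₃ = ≤-trans (m≤n*m S₂ A) AS₂≤3S₃

    Δ≤Θ : Δ ≤ Θ
    Δ≤Θ = +-mono-≤ (+-mono-≤ (^-monoˡ-≤ 2 a≤Ca) (*-mono-≤ a≤Ca b≤Ab)) (^-monoˡ-≤ 2 b≤Ab)
      where
      a≤Ca : a ≤ C * a
      a≤Ca = m≤n*m a C
      b≤Ab : b ≤ A * b
      b≤Ab = m≤n*m b A

    -- This is AM-GM for AB, BC and CA, whose product is `S₃²`; it follows by dropping `R` and `Θ`
    -- from the two identities above.
    27S₃²≤S₂³ : 27 * (S₃ * S₃) ≤ S₂ * S₂ * S₂
    27S₃²≤S₂³ = begin
      27 * (S₃ * S₃)             ≡⟨ solve 1 (λ z → con 27 :* (z :* z) := con 3 :* (con 9 :* z) :* z) refl S₃ ⟩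
      3 * (9 * S₃) * S₃
        ≤⟨ *-monoˡ-≤ S₃ (*-monoʳ-≤ 3 (subst (9 * S₃ ≤_) (sym S₁S₂≡) (m≤m+n (9 * S₃) R))) ⟩
      3 * (S₁ * S₂) * S₃
        ≡⟨ solve 3 (λ x y z → con 3 :* (x :* y) :* z := con 3 :* x :* z :* y) refl S₁ S₂ S₃ ⟩
      3 * S₁ * S₃ * S₂           ≤⟨ *-monoˡ-≤ S₂ (subst (3 * S₁ * S₃ ≤_) (sym S₂²≡) (m≤m+n _ Θ)) ⟩
      S₂ * S₂ * S₂               ∎

    module _ (h k : ℕ) .{{_ : NonZero h}} (kS₃≡ : k * S₃ ≡ h * S₂ + S₁) where

      n : ℕ
      n = (A * h + 1) * (B * h + 1) * (C * h + 1)

      1≤k : 1 ≤ k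
      1≤k = n≢0⇒n>0 λ { k≡0 → ≢-nonZero⁻¹ A (m+n≡0⇒m≡0 A (m+n≡0⇒m≡0 (A + B) (m+n≡0⇒n≡0 (h * S₂)
              (trans (sym kS₃≡) (cong (_* S₃) k≡0))))) }

      -- Expanding gives `n = h³ S₃ + h (h S₂ + S₁) + 1`. After multiplication by `S₂³`, the part
      -- `3 S₁ S₃` of `S₂²` supplies the mixed terms of `(h S₂ + S₁)³ S₃`, and the added `S₁³ S₃`
      -- completes the cube, which equals `k³ S₃⁴`.
      power-identity : n * S₂ ^ 3 + S₁ ^ 3 * S₃ ≡ k ^ 3 * S₃ ^ 4 + k * h * S₂ * S₃ * Θ + S₂ ^ 3
      power-identity = begin-equality
        n * S₂ ^ 3 + S₁ ^ 3 * S₃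
          ≡⟨ solve 7 (λ A B C h y₁ y₂ y₃ →
               (A :* h :+ con 1) :* (B :* h :+ con 1) :* (C :* h :+ con 1) :* y₂ :^ 3 :+ y₁ :^ 3 :* y₃ :=
               (h :^ 3 :* :e₃ A B C :+ h :* (h :* :e₂ A B C :+ :e₁ A B C) :+ con 1) :* y₂ :^ 3 :+ y₁ :^ 3 :* y₃)
               refl A B C h S₁ S₂ S₃ ⟩
        (h ^ 3 * S₃ + h * (h * S₂ + S₁) + 1) * S₂ ^ 3 + S₁ ^ 3 * S₃
          ≡⟨ solve 4 (λ h x y z → (h :^ 3 :* z :+ h :* (h :* y :+ x) :+ con 1) :* y :^ 3 :+ x :^ 3 :* z :=
               h :^ 3 :* z :* y :^ 3 :+ x :^ 3 :* z :+ h :* y :* (h :* y :+ x) :* (y :* y) :+ y :^ 3)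
               refl h S₁ S₂ S₃ ⟩
        h ^ 3 * S₃ * S₂ ^ 3 + S₁ ^ 3 * S₃ + h * S₂ * (h * S₂ + S₁) * (S₂ * S₂) + S₂ ^ 3
          ≡⟨ cong (λ s → h ^ 3 * S₃ * S₂ ^ 3 + S₁ ^ 3 * S₃ + h * S₂ * (h * S₂ + S₁) * s + S₂ ^ 3) S₂²≡ ⟩
        h ^ 3 * S₃ * S₂ ^ 3 + S₁ ^ 3 * S₃ + h * S₂ * (h * S₂ + S₁) * (3 * S₁ * S₃ + Θ) + S₂ ^ 3
          ≡⟨ solve 5 (λ h x y z t → h :^ 3 :* z :* y :^ 3 :+ x :^ 3 :* z :+
            h :* y :* (h :* y :+ x) :* (con 3 :* x :* z :+ t) :+ y :^ 3 :=
               (h :* y :+ x) :^ 3 :* z :+ h :* y :* (h :* y :+ x) :* t :+ y :^ 3) refl h S₁ S₂ S₃ Θ ⟩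
        (h * S₂ + S₁) ^ 3 * S₃ + h * S₂ * (h * S₂ + S₁) * Θ + S₂ ^ 3
          ≡⟨ cong (λ s → s ^ 3 * S₃ + h * S₂ * s * Θ + S₂ ^ 3) (sym kS₃≡) ⟩
        (k * S₃) ^ 3 * S₃ + h * S₂ * (k * S₃) * Θ + S₂ ^ 3
          ≡⟨ solve 5 (λ h k y z t → (k :* z) :^ 3 :* z :+ h :* y :* (k :* z) :* t :+ y :^ 3 :=
               k :^ 3 :* z :^ 4 :+ k :* h :* y :* z :* t :+ y :^ 3) refl h k S₂ S₃ Θ ⟩
        k ^ 3 * S₃ ^ 4 + k * h * S₂ * S₃ * Θ + S₂ ^ 3 ∎

      -- The term added to complete the cube is absorbed by the surplus on the right of
      -- `power-identity`: three times it is at most `S₁² S₂² = 3 S₂³ + Δ S₂²`, and here `Δ ≤ Θ` and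
      -- `S₂ ≤ 3 S₃`.
      S₁³S₃≤ : S₁ ^ 3 * S₃ ≤ k * h * S₂ * S₃ * Θ + S₂ ^ 3
      S₁³S₃≤ = *-cancelˡ-≤ 3 (begin
        3 * (S₁ ^ 3 * S₃)
          ≡⟨ solve 2 (λ x z → con 3 :* (x :^ 3 :* z) := x :* x :* (con 3 :* x :* z)) refl S₁ S₃ ⟩
        S₁ * S₁ * (3 * S₁ * S₃)
          ≤⟨ *-monoʳ-≤ (S₁ * S₁) (subst (3 * S₁ * S₃ ≤_) (sym S₂²≡) (m≤m+n _ Θ)) ⟩
        S₁ * S₁ * (S₂ * S₂)                      ≡⟨ cong (_* (S₂ * S₂)) S₁²≡ ⟩
        (3 * S₂ + Δ) * (S₂ * S₂)
          ≡⟨ solve 2 (λ y d → (con 3 :* y :+ d) :* (y :* y) := d :* y :* y :+ con 3 :* y :^ 3) refl S₂ Δ ⟩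
        Δ * S₂ * S₂ + 3 * S₂ ^ 3
          ≤⟨ +-monoˡ-≤ (3 * S₂ ^ 3) (*-mono-≤ (*-monoˡ-≤ S₂ Δ≤Θ) S₂≤3S₃) ⟩
        Θ * S₂ * (3 * S₃) + 3 * S₂ ^ 3
          ≤⟨ +-monoˡ-≤ (3 * S₂ ^ 3) (m≤n*m (Θ * S₂ * (3 * S₃)) (k * h) {{m*n≢0 k h {{>-nonZero 1≤k}}}}) ⟩
        k * h * (Θ * S₂ * (3 * S₃)) + 3 * S₂ ^ 3
          ≡⟨ solve 5 (λ h k y z t → k :* h :* (t :* y :* (con 3 :* z)) :+ con 3 :* y :^ 3 :=
            con 3 :* (k :* h :* y :* z :* t :+ y :^ 3)) refl h k S₂ S₃ Θ ⟩
        3 * (k * h * S₂ * S₃ * Θ + S₂ ^ 3)       ∎)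

      k³S₃⁴≤nS₂³ : k ^ 3 * S₃ ^ 4 ≤ n * S₂ ^ 3
      k³S₃⁴≤nS₂³ = +-cancelʳ-≤ (S₁ ^ 3 * S₃) _ _ (begin
        k ^ 3 * S₃ ^ 4 + S₁ ^ 3 * S₃                        ≤⟨ +-monoʳ-≤ (k ^ 3 * S₃ ^ 4) S₁³S₃≤ ⟩
        k ^ 3 * S₃ ^ 4 + (k * h * S₂ * S₃ * Θ + S₂ ^ 3)     ≡⟨ sym (+-assoc (k ^ 3 * S₃ ^ 4) _ _) ⟩
        k ^ 3 * S₃ ^ 4 + k * h * S₂ * S₃ * Θ + S₂ ^ 3       ≡⟨ sym power-identity ⟩
        n * S₂ ^ 3 + S₁ ^ 3 * S₃                            ∎)

      -- 3 S₃ / S₂ is the harmonic mean of A, B, C, which is at most their geometric mean.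
      k³M⁶≤n : ∀ c M → M * S₂ ≤ 3 * c * S₃ → k ^ 3 * M ^ 6 ≤ 27 * c ^ 6 * n
      k³M⁶≤n c M MS₂≤ = *-cancelʳ-≤ _ _ (S₂ ^ 3) {{m^n≢0 S₂ 3}} (begin
        k ^ 3 * M ^ 6 * S₂ ^ 3                          ≡⟨ solve 3 (λ k m y → k :^ 3 :* m :^ 6 :* y :^ 3 :=
            k :^ 3 :* m :^ 3 :* (m :^ 3 :* y :^ 3)) refl k M S₂ ⟩
        k ^ 3 * M ^ 3 * (M ^ 3 * S₂ ^ 3)                ≤⟨ *-mono-≤ (*-monoʳ-≤ (k ^ 3) M³≤) M³S₂³≤ ⟩
        k ^ 3 * (c ^ 3 * S₃) * (3 * c * S₃) ^ 3
          ≡⟨ solve 3 (λ c k z → k :^ 3 :* (c :^ 3 :* z) :* (con 3 :* c :* z) :^ 3 :=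
            con 27 :* c :^ 6 :* (k :^ 3 :* z :^ 4)) refl c k S₃ ⟩
        27 * c ^ 6 * (k ^ 3 * S₃ ^ 4)                   ≤⟨ *-monoʳ-≤ (27 * c ^ 6) k³S₃⁴≤nS₂³ ⟩
        27 * c ^ 6 * (n * S₂ ^ 3)                       ≡⟨ sym (*-assoc (27 * c ^ 6) n (S₂ ^ 3)) ⟩
        27 * c ^ 6 * n * S₂ ^ 3                         ∎)
        where
        M³S₂³≤ : M ^ 3 * S₂ ^ 3 ≤ (3 * c * S₃) ^ 3
        M³S₂³≤ = subst (_≤ (3 * c * S₃) ^ 3) (^-distribʳ-* 3 M S₂) (^-monoˡ-≤ 3 MS₂≤)
        M³≤ : M ^ 3 ≤ c ^ 3 * S₃
        M³≤ = *-cancelʳ-≤ _ _ (S₂ ^ 3) {{m^n≢0 S₂ 3}} (begin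
          M ^ 3 * S₂ ^ 3                 ≤⟨ M³S₂³≤ ⟩
          (3 * c * S₃) ^ 3
            ≡⟨ solve 2 (λ c z → (con 3 :* c :* z) :^ 3 := c :^ 3 :* z :* (con 27 :* (z :* z))) refl c S₃ ⟩
          c ^ 3 * S₃ * (27 * (S₃ * S₃))  ≤⟨ *-monoʳ-≤ (c ^ 3 * S₃) 27S₃²≤S₂³ ⟩
          c ^ 3 * S₃ * (S₂ * S₂ * S₂)
            ≡⟨ solve 3 (λ c y z → c :^ 3 :* z :* (y :* y :* y) := c :^ 3 :* z :* y :^ 3) refl c S₂ S₃ ⟩
          c ^ 3 * S₃ * S₂ ^ 3            ∎)

  -- The case k = 1: a lower bound for the spread `v`.

  module Gap (A a b : ℕ) .{{_ : NonZero A}} where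
    open Triple A a b

    -- This bound and the next two compare `S₂`, `S₁` and `R` with multiples of `B + C`, the factor
    -- that is cancelled in `3A≤2v²+27`.
    2S₂≥ : 3 * A * (B + C) ≤ 2 * S₂
    2S₂≥ = subst (3 * A * (B + C) ≤_)
      (solve 3 (λ A a b → let B = A :+ a; C = A :+ a :+ b in
        con 3 :* A :* (B :+ C) :+ (B :* (a :+ b) :+ C :* a) := con 2 :* :e₂ A B C) refl A a b)
      (m≤m+n (3 * A * (B + C)) (B * v + C * a))

    2S₁≤ : 2 * S₁ ≤ 3 * (B + C)
    2S₁≤ = subst (2 * S₁ ≤_)
      (solve 3 (λ A a b → let B = A :+ a; C = A :+ a :+ b in
        con 2 :* :e₁ A B C :+ (a :+ (a :+ b)) := con 3 :* (B :+ C)) refl A a b)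
      (m≤m+n (2 * S₁) (a + v))

    R≤ : R ≤ (B + C) * v ^ 2
    R≤ = subst (R ≤_)
      (solve 3 (λ A a b → let B = A :+ a; C = A :+ a :+ b; v = a :+ b in
        A :* b :^ 2 :+ B :* v :^ 2 :+ C :* a :^ 2 :+ (con 2 :* C :* a :* b :+ v :* b :^ 2) :=
        (B :+ C) :* v :^ 2) refl A a b)
      (m≤m+n R (2 * C * a * b + v * b ^ 2))

    module _ (h : ℕ) (S₃≡ : S₃ ≡ h * S₂ + S₁) where

      9S₃≡ : 9 * S₃ ≡ 9 * h * S₂ + 9 * S₁
      9S₃≡ = trans (cong (9 *_) S₃≡)
        (solve 3 (λ h x y → con 9 :* (h :* y :+ x) := con 9 :* h :* y :+ con 9 :* x) refl h S₁ S₂)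

      S₁S₂≡′ : S₁ * S₂ ≡ 9 * h * S₂ + (9 * S₁ + R)
      S₁S₂≡′ = trans S₁S₂≡ (trans (cong (_+ R) 9S₃≡) (+-assoc (9 * h * S₂) (9 * S₁) R))

      -- Substituting `S₃ = h S₂ + S₁` into `S₁ S₂ = 9 S₃ + R` leaves the positive remainder
      -- `9 S₁ + R` beyond `9 h S₂`.
      9h<S₁ : 9 * h < S₁
      9h<S₁ = *-cancelʳ-< S₂ (9 * h) S₁ (begin-strict
        9 * h * S₂                   <⟨ m<m+n (9 * h * S₂) (≤-trans 1≤A (≤-trans
            (≤-trans (m≤m+n A B) (m≤m+n (A + B) C)) (≤-trans (m≤n*m S₁ 9) (m≤m+n (9 * S₁) R)))) ⟩
        9 * h * S₂ + (9 * S₁ + R)    ≡⟨ sym S₁S₂≡′ ⟩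
        S₁ * S₂                      ∎)

      -- S₁ S₂ - 9 S₃ + 9 S₁ = (S₁ - 9 h) S₂ is a positive multiple of S₂.
      S₂≤ : S₂ ≤ 9 * S₁ + R
      S₂≤ = +-cancelʳ-≤ (9 * h * S₂) _ _ (begin
        S₂ + 9 * h * S₂              ≤⟨ *-monoˡ-≤ S₂ 9h<S₁ ⟩
        S₁ * S₂                      ≡⟨ S₁S₂≡′ ⟩
        9 * h * S₂ + (9 * S₁ + R)    ≡⟨ +-comm (9 * h * S₂) _ ⟩
        9 * S₁ + R + 9 * h * S₂      ∎)

      3A≤2v²+27 : 3 * A ≤ 2 * v ^ 2 + 27
      3A≤2v²+27 = *-cancelʳ-≤ _ _ (B + C) {{>-nonZero (≤-trans (>-nonZero⁻¹ B) (m≤m+n B C))}} (begin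
        3 * A * (B + C)                              ≤⟨ 2S₂≥ ⟩
        2 * S₂                                       ≤⟨ *-monoʳ-≤ 2 S₂≤ ⟩
        2 * (9 * S₁ + R)
          ≡⟨ solve 2 (λ x r → con 2 :* (con 9 :* x :+ r) := con 9 :* (con 2 :* x) :+ con 2 :* r) refl S₁ R ⟩
        9 * (2 * S₁) + 2 * R                         ≤⟨ +-mono-≤ (*-monoʳ-≤ 9 2S₁≤) (*-monoʳ-≤ 2 R≤) ⟩
        9 * (3 * (B + C)) + 2 * ((B + C) * v ^ 2)
          ≡⟨ solve 2 (λ s v → con 9 :* (con 3 :* s) :+ con 2 :* (s :* v :^ 2) :=
            (con 2 :* v :^ 2 :+ con 27) :* s) refl (B + C) v ⟩
        (2 * v ^ 2 + 27) * (B + C)                   ∎)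

  -- Harmonic means of the extremal triples, with c = 8.

  harmonic-5 : ∀ A → 1 ≤ A → (8 * A + 5) * e₂ A (A + 1) (A + 2) ≤ 24 * e₃ A (A + 1) (A + 2)
  harmonic-5 A 1≤A with α , refl ← m≤n⇒∃[o]m+o≡n 1≤A = m+n≤o⇒m≤o _ (≤-reflexive
    (solve 1 (λ α → let A = con 1 :+ α; B = A :+ con 1; C = A :+ con 2 in
      (con 8 :* A :+ con 5) :* :e₂ A B C :+ (con 9 :* α :^ 2 :+ con 20 :* α :+ con 1) := con 24 :* :e₃ A B C) refl α))

  -- The slack has non-negative coefficients in α = A - 5. At A = 4 the inequality fails, so the
  -- bound on `A` is sharp.
  harmonic-7 : ∀ A → 5 ≤ A → (8 * A + 7) * e₂ A (A + 1) (A + 2) ≤ 24 * e₃ A (A + 1) (A + 2)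
  harmonic-7 A 5≤A with α , refl ← m≤n⇒∃[o]m+o≡n 5≤A = m+n≤o⇒m≤o _ (≤-reflexive
    (solve 1 (λ α → let A = con 5 :+ α; B = A :+ con 1; C = A :+ con 2 in
      (con 8 :* A :+ con 7) :* :e₂ A B C :+ (con 3 :* α :^ 2 :+ con 20 :* α :+ con 11) := con 24 :* :e₃ A B C) refl α))

  -- The slack is `2 A v (A - 2 v)`, which is where `2 * v ≤ A` enters.
  harmonic-2v : ∀ A v → 2 * v ≤ A → (8 * A + 2 * v) * e₂ A A (A + v) ≤ 24 * e₃ A A (A + v)
  harmonic-2v A v 2v≤A with d , refl ← m≤n⇒∃[o]m+o≡n 2v≤A = m+n≤o⇒m≤o _ (≤-reflexive
    (solve 2 (λ v d → let A = con 2 :* v :+ d; C = A :+ v in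
      (con 8 :* A :+ con 2 :* v) :* :e₂ A A C :+ A :* (con 2 :* v :* d) := con 24 :* :e₃ A A C) refl v d))

  -- The two sides differ by `3 A² (2 v - A)`.
  harmonic-A : ∀ A v → A ≤ 2 * v → (8 * A + A) * e₂ A A (A + v) ≤ 24 * e₃ A A (A + v)
  harmonic-A A v A≤2v = begin
    (8 * A + A) * e₂ A A (A + v)
      ≡⟨ solve 2 (λ A v → (con 8 :* A :+ A) :* :e₂ A A (A :+ v) := con 27 :* A :^ 3 :+ con 18 :* A :* A :* v) refl A v ⟩
    27 * A ^ 3 + 18 * A * A * v
      ≡⟨ solve 2 (λ A v → con 27 :* A :^ 3 :+ con 18 :* A :* A :* v := con 24 :* A :^ 3 :+ con 18 :* A :* A :* v :+ con 3 :* A :* A :* A) refl A v ⟩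
    24 * A ^ 3 + 18 * A * A * v + 3 * A * A * A
      ≤⟨ +-monoʳ-≤ (24 * A ^ 3 + 18 * A * A * v) (*-monoʳ-≤ (3 * A * A) A≤2v) ⟩
    24 * A ^ 3 + 18 * A * A * v + 3 * A * A * (2 * v)
      ≡⟨ solve 2 (λ A v → con 24 :* A :^ 3 :+ con 18 :* A :* A :* v :+ con 3 :* A :* A :* (con 2 :* v) := con 24 :* :e₃ A A (A :+ v)) refl A v ⟩
    24 * e₃ A A (A + v) ∎

  -- For w = W / c this says 24 w² > A + w and (A + w)⁶ ≤ 27 n.
  Excess : ℕ → ℕ → Set
  Excess A n = ∃[ c ] ∃[ W ] (c * (c * A + W) < 24 * W ^ 2 × (c * A + W) ^ 6 ≤ 27 * c ^ 6 * n)

  -- The excess for k = 1 and for k ≥ 2.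

  module _ (A a b h : ℕ) .{{_ : NonZero A}} .{{_ : NonZero a}} .{{_ : NonZero b}} .{{_ : NonZero h}} where
    open Triple A a b

    module _ (S₃≡ : 1 * S₃ ≡ h * S₂ + S₁) where

      gap : 3 * A ≤ 2 * v ^ 2 + 27
      gap = Gap.3A≤2v²+27 A a b h (trans (sym (*-identityˡ S₃)) S₃≡)

      excess : ∀ c W {B₀ C₀} .{{_ : NonZero B₀}} .{{_ : NonZero C₀}} → B₀ ≤ B → C₀ ≤ C → c * (c * A + W) < 24 * W ^ 2 →
               (c * A + W) * e₂ A B₀ C₀ ≤ 3 * c * e₃ A B₀ C₀ → Excess A (n h 1 S₃≡)
      excess c W B₀≤B C₀≤C small hm = c , W , small ,
        subst (_≤ 27 * c ^ 6 * n h 1 S₃≡) (*-identityˡ ((c * A + W) ^ 6))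
          (k³M⁶≤n h 1 S₃≡ c (c * A + W) (harmonic-mono (c * A + W) (3 * c) A B₀≤B C₀≤C hm))

      excess-8 : ∀ W {B₀ C₀} .{{_ : NonZero B₀}} .{{_ : NonZero C₀}} → B₀ ≤ B → C₀ ≤ C → 8 * A + W < 3 * W ^ 2 →
                 (8 * A + W) * e₂ A B₀ C₀ ≤ 24 * e₃ A B₀ C₀ → Excess A (n h 1 S₃≡)
      excess-8 W B₀≤B C₀≤C small = excess 8 W B₀≤B C₀≤C
        (subst (8 * (8 * A + W) <_) (sym (*-assoc 8 3 (W ^ 2))) (*-monoʳ-< 8 small))

      A+1≤B : A + 1 ≤ B
      A+1≤B = +-monoʳ-≤ A (>-nonZero⁻¹ a)

      A+2≤C : A + 2 ≤ C
      A+2≤C = subst (A + 2 ≤_) (sym (+-assoc A a b)) (+-monoʳ-≤ A (+-mono-≤ (>-nonZero⁻¹ a) (>-nonZero⁻¹ b)))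

      A+v≤C : A + v ≤ C
      A+v≤C = ≤-reflexive (sym (+-assoc A a b))

      instance
        A+m≢0 : ∀ {m} → NonZero (A + m)
        A+m≢0 {m} = >-nonZero (≤-trans 1≤A (m≤m+n A m))

      4≤v : 16 ≤ A → 4 ≤ v
      4≤v 16≤A = ≮⇒≥ λ v<4 → <⇒≱ (begin-strict
        2 * v ^ 2 + 27   ≤⟨ +-monoˡ-≤ 27 (*-monoʳ-≤ 2 (^-monoˡ-≤ 2 (s≤s⁻¹ v<4))) ⟩
        45               <⟨ ≤ᵇ⇒≤ 46 48 _ ⟩
        48               ≤⟨ *-monoʳ-≤ 3 16≤A ⟩
        3 * A            ∎) gap

      small-2v : 4 ≤ v → 8 * A + 2 * v < 3 * (2 * v) ^ 2
      small-2v 4≤v = *-cancelˡ-< 3 _ _ (begin-strict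
        3 * (8 * A + 2 * v)
          ≡⟨ solve 2 (λ A v → con 3 :* (con 8 :* A :+ con 2 :* v) :=
              con 8 :* (con 3 :* A) :+ con 6 :* v) refl A v ⟩
        8 * (3 * A) + 6 * v             ≤⟨ +-monoˡ-≤ (6 * v) (*-monoʳ-≤ 8 gap) ⟩
        8 * (2 * v ^ 2 + 27) + 6 * v    <⟨ bound v 4≤v ⟩
        3 * (3 * (2 * v) ^ 2)           ∎)
        where
        -- The claim amounts to `20 v² > 6 v + 216`, true from v = 4 on and false at v = 3. As v ≤ 3
        -- gives only `3 A ≤ 45`, this dictates the threshold A ≥ 16.
        bound : ∀ v → 4 ≤ v → 8 * (2 * v ^ 2 + 27) + 6 * v < 3 * (3 * (2 * v) ^ 2)
        bound v 4≤v with x , refl ← m≤n⇒∃[o]m+o≡n 4≤v = m+n≤o⇒m≤o _ (≤-reflexive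
          (solve 1 (λ x → let v = con 4 :+ x in
            con 1 :+ (con 8 :* (con 2 :* v :^ 2 :+ con 27) :+ con 6 :* v) :+ (con 20 :* x :^ 2 :+ con 154 :* x :+ con 79) :=
            con 3 :* (con 3 :* (con 2 :* v) :^ 2)) refl x))

      small-A : 16 ≤ A → 8 * A + A < 3 * A ^ 2
      small-A 16≤A = subst₂ _<_
        (solve 1 (λ A → con 9 :* A := con 8 :* A :+ A) refl A)
        (solve 1 (λ A → con 3 :* A :* A := con 3 :* A :^ 2) refl A)
        (*-monoˡ-< A (≤-trans (≤ᵇ⇒≤ 10 48 _) (*-monoʳ-≤ 3 16≤A)))

      excess-k≡1 : Excess A (n h 1 S₃≡)
      excess-k≡1 with A ≤? 8
      -- W = 5 works up to A = 8, where 8 A + 5 = 69 < 75 = 3 W².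
      ... | yes A≤8 = excess-8 5 {A + 1} {A + 2} A+1≤B A+2≤C
                        (≤-<-trans (+-monoˡ-≤ 5 (*-monoʳ-≤ 8 A≤8)) (≤ᵇ⇒≤ 70 75 _)) (harmonic-5 A 1≤A)
      ... | no A≰8 with A ≤? 15
      -- W = 7 bridges the range up to 15: there 8 A + 7 ≤ 127 < 147 = 3 W².
      ... | yes A≤15 = excess-8 7 {A + 1} {A + 2} A+1≤B A+2≤C
                         (≤-<-trans (+-monoˡ-≤ 7 (*-monoʳ-≤ 8 A≤15)) (≤ᵇ⇒≤ 128 147 _))
                         (harmonic-7 A (≤-trans (≤ᵇ⇒≤ 5 9 _) (≰⇒> A≰8)))
      ... | no A≰15 with 2 * v ≤? A
      ... | yes 2v≤A = excess-8 (2 * v) {A} {A + v} A≤B A+v≤C (small-2v (4≤v (≰⇒> A≰15))) (harmonic-2v A v 2v≤A)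
      ... | no 2v≰A  = excess-8 A {A} {A + v} A≤B A+v≤C (small-A (≰⇒> A≰15)) (harmonic-A A v (<⇒≤ (≰⇒> 2v≰A)))

    module _ (k : ℕ) (kS₃≡ : k * S₃ ≡ h * S₂ + S₁) where

      -- Here the harmonic mean is used only through its lower bound `A`; the factor `k³` pays for
      -- raising `c A` to `(c + w) A`.
      excess-multiple : ∀ c w m → m ≤ k → c * (c + w) < 24 * w ^ 2 → (c + w) ^ 6 ≤ m ^ 3 * c ^ 6 →
                        Excess A (n h k kS₃≡)
      excess-multiple c w m m≤k small c+w≤ = c , w * A , scaled-small , (begin
          (c * A + w * A) ^ 6         ≡⟨ cong (_^ 6) (sym (*-distribʳ-+ A c w)) ⟩
          ((c + w) * A) ^ 6           ≡⟨ ^-distribʳ-* 6 (c + w) A ⟩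
          (c + w) ^ 6 * A ^ 6
            ≤⟨ *-monoˡ-≤ (A ^ 6) (≤-trans c+w≤ (*-monoˡ-≤ (c ^ 6) (^-monoˡ-≤ 3 m≤k))) ⟩
          k ^ 3 * c ^ 6 * A ^ 6       ≡⟨ *-assoc (k ^ 3) (c ^ 6) (A ^ 6) ⟩
          k ^ 3 * (c ^ 6 * A ^ 6)     ≡⟨ cong (k ^ 3 *_) (sym (^-distribʳ-* 6 c A)) ⟩
          k ^ 3 * (c * A) ^ 6         ≤⟨ k³M⁶≤n h k kS₃≡ c (c * A) cAS₂≤ ⟩
          27 * c ^ 6 * n h k kS₃≡     ∎)
        where
        cAS₂≤ : c * A * S₂ ≤ 3 * c * S₃
        cAS₂≤ = subst₂ _≤_ (sym (*-assoc c A S₂))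
          (solve 2 (λ c z → c :* (con 3 :* z) := con 3 :* c :* z) refl c S₃) (*-monoʳ-≤ c AS₂≤3S₃)
        -- The left side is linear in `A` and the right side quadratic, so the case A = 1 implies
        -- the others.
        scaled-small : c * (c * A + w * A) < 24 * (w * A) ^ 2
        scaled-small = begin-strict
          c * (c * A + w * A)
            ≡⟨ solve 3 (λ A c w → c :* (c :* A :+ w :* A) := c :* (c :+ w) :* A) refl A c w ⟩
          c * (c + w) * A         <⟨ *-monoˡ-< A small ⟩
          24 * w ^ 2 * A          ≤⟨ m≤m*n (24 * w ^ 2 * A) A ⟩
          24 * w ^ 2 * A * A
            ≡⟨ solve 2 (λ A w → con 24 :* w :^ 2 :* A :* A := con 24 :* (w :* A) :^ 2) refl A w ⟩
          24 * (w * A) ^ 2        ∎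

      excess-k≥2 : 2 ≤ k → Excess A (n h k kS₃≡)
      -- The two computed facts are 5 · 7 = 35 < 96 = 24 · 2² and 7⁶ = 117649 ≤ 125000 = 2³ · 5⁶.
      excess-k≥2 2≤k = excess-multiple 5 2 2 2≤k (≤ᵇ⇒≤ _ _ _) (≤ᵇ⇒≤ _ _ _)

  -- From the Korselt conditions to the divisibility by `e₃`.

  coprime-product-∣ : ∀ {A B m} → Coprime A B → A ∣ m → B ∣ m → A * B ∣ m
  coprime-product-∣ {A} {B} c (divides-refl x) B∣m =
    subst (A * B ∣_) (*-comm A x) (*-monoʳ-∣ A (coprime-divisor (Coprime.sym c) (subst (B ∣_) (*-comm x A) B∣m)))

  coprime-* : ∀ {A B C} → Coprime A C → Coprime B C → Coprime (A * B) C
  coprime-* A⊥C B⊥C (d∣AB , d∣C) =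
    B⊥C (coprime-divisor (λ (e∣d , e∣A) → A⊥C (e∣A , ∣-trans e∣d d∣C)) d∣AB , d∣C)

  e₃∣ : ∀ {A B C m} → Coprime A B → Coprime A C → Coprime B C → A ∣ m → B ∣ m → C ∣ m → e₃ A B C ∣ m
  e₃∣ A⊥B A⊥C B⊥C A∣ B∣ C∣ = coprime-product-∣ (coprime-* A⊥C B⊥C) (coprime-product-∣ A⊥B A∣ B∣) C∣

  -- A common divisor of A and B divides h e₂ + e₁, hence C.
  pairwise-coprime : ∀ A B C h → (∀ {d} → d ∣ A → d ∣ B → d ∣ C → d ≡ 1) →
                     A ∣ h * e₂ A B C + e₁ A B C → Coprime A B
  pairwise-coprime A B C h coprime A∣ {d} (d∣A , d∣B) = coprime d∣A d∣B
    (∣m+n∣m⇒∣n (subst (d ∣_) regroup (∣-trans d∣A A∣))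
      (∣m∣n⇒∣m+n (∣m⇒∣m*n (h * B + h * C + 1) d∣A) (∣m⇒∣m*n (h * C + 1) d∣B)))
    where
    regroup : h * e₂ A B C + e₁ A B C ≡ A * (h * B + h * C + 1) + B * (h * C + 1) + C
    regroup = solve 4 (λ h A B C → h :* :e₂ A B C :+ :e₁ A B C :=
      A :* (h :* B :+ h :* C :+ con 1) :+ B :* (h :* C :+ con 1) :+ C) refl h A B C

  e-rotate : ∀ h A B C → h * e₂ A B C + e₁ A B C ≡ h * e₂ B C A + e₁ B C A
  e-rotate = solve 4 (λ h A B C → h :* :e₂ A B C :+ :e₁ A B C := h :* :e₂ B C A :+ :e₁ B C A) refl

  korselt-expand : ∀ h A B C → (A * h + 1) * (B * h + 1) * (C * h + 1) ∸ 1 ≡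
                               (h ^ 2 * e₃ A B C + (h * e₂ A B C + e₁ A B C)) * h
  korselt-expand h A B C = trans (cong (_∸ 1) (expand h A B C)) (m+n∸n≡m _ 1)
    where
    expand : ∀ h A B C → (A * h + 1) * (B * h + 1) * (C * h + 1) ≡
                         (h ^ 2 * e₃ A B C + (h * e₂ A B C + e₁ A B C)) * h + 1
    expand = solve 4 (λ h A B C → (A :* h :+ con 1) :* (B :* h :+ con 1) :* (C :* h :+ con 1) :=
                         (h :^ 2 :* :e₃ A B C :+ (h :* :e₂ A B C :+ :e₁ A B C)) :* h :+ con 1) refl

  module KorseltTriple {n : ℕ} (K : K₃N n) where
    open K₃N K

    H∣q-1×r-1 : H ∣ gcd (q ∸ 1) (r ∸ 1)
    H∣q-1×r-1 = gcd[m,n]∣n (p ∸ 1) (gcd (q ∸ 1) (r ∸ 1))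

    B C : ℕ
    B = (q ∸ 1) / H
    C = (r ∸ 1) / H

    B-exact : B * H ≡ q ∸ 1
    B-exact = m/n*n≡m (∣-trans H∣q-1×r-1 (gcd[m,n]∣m (q ∸ 1) (r ∸ 1)))

    C-exact : C * H ≡ r ∸ 1
    C-exact = m/n*n≡m (∣-trans H∣q-1×r-1 (gcd[m,n]∣n (q ∸ 1) (r ∸ 1)))

    1<q : 1 < q
    1<q = <-trans 1<p p<q

    1<r : 1 < r
    1<r = <-trans 1<q q<r

    pred-exact : ∀ X {s} → 1 < s → X * H ≡ s ∸ 1 → s ≡ X * H + 1
    pred-exact X 1<s eq = trans (sym (m∸n+n≡m (<⇒≤ 1<s))) (cong (_+ 1) (sym eq))

    n≡ : n ≡ (A * H + 1) * (B * H + 1) * (C * H + 1)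
    n≡ = trans n≡pqr (cong₂ _*_ (cong₂ _*_ (pred-exact A 1<p A-exact) (pred-exact B 1<q B-exact)) (pred-exact C 1<r C-exact))

    n-1≡ : n ∸ 1 ≡ (H ^ 2 * e₃ A B C + (H * e₂ A B C + e₁ A B C)) * H
    n-1≡ = trans (cong (_∸ 1) n≡) (korselt-expand H A B C)

    S : ℕ
    S = H * e₂ A B C + e₁ A B C

    -- Cancelling `H` in `n - 1 = (H² e₃ + S) H` shows that `X` divides `H² e₃ + S`, and the first
    -- summand is a multiple of `X`.
    ∣S : ∀ {X s} → X * H ≡ s → s ∣ n ∸ 1 → X ∣ e₃ A B C → X ∣ S
    ∣S {X} refl XH∣ X∣e₃ = ∣m+n∣m⇒∣n (*-cancelʳ-∣ H (subst (X * H ∣_) n-1≡ XH∣)) (∣n⇒∣m*n (H ^ 2) X∣e₃)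

    A∣S : A ∣ S
    A∣S = ∣S A-exact p-1∣n-1 (∣m⇒∣m*n C (m∣m*n B))

    B∣S : B ∣ S
    B∣S = ∣S B-exact q-1∣n-1 (∣m⇒∣m*n C (n∣m*n A))

    C∣S : C ∣ S
    C∣S = ∣S C-exact r-1∣n-1 (n∣m*n (A * B))

    -- For a common divisor `d`, the number `d * H` divides p - 1, q - 1 and r - 1, hence their gcd
    -- `H`.
    coprime-ABC : ∀ {d} → d ∣ A → d ∣ B → d ∣ C → d ≡ 1
    coprime-ABC {d} d∣A d∣B d∣C = ∣1⇒≡1 (*-cancelʳ-∣ H (subst (d * H ∣_) (sym (*-identityˡ H))
      (gcd-greatest (dH∣ A-exact d∣A) (gcd-greatest (dH∣ B-exact d∣B) (dH∣ C-exact d∣C)))))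
      where
      dH∣ : ∀ {X s} → X * H ≡ s → d ∣ X → d * H ∣ s
      dH∣ refl d∣X = *-monoˡ-∣ H d∣X

    S₃∣S : e₃ A B C ∣ S
    S₃∣S = e₃∣
      (pairwise-coprime A B C H coprime-ABC A∣S)
      -- `S` is invariant under cyclic rotation, so one lemma serves all three pairs.
      (Coprime.sym (pairwise-coprime C A B H (λ d∣C d∣A d∣B → coprime-ABC d∣A d∣B d∣C)
        (subst (C ∣_) (sym (e-rotate H C A B)) C∣S)))
      (pairwise-coprime B C A H (λ d∣B d∣C d∣A → coprime-ABC d∣A d∣B d∣C)
        (subst (B ∣_) (e-rotate H A B C) B∣S))
      A∣S B∣S C∣S

    A<B : A < B
    A<B = *-cancelʳ-< H A B (subst₂ _<_ (sym A-exact) (sym B-exact) (∸-monoˡ-< p<q (<⇒≤ 1<p)))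

    B<C : B < C
    B<C = *-cancelʳ-< H B C (subst₂ _<_ (sym B-exact) (sym C-exact) (∸-monoˡ-< q<r (<⇒≤ 1<q)))

    0<A : 0 < A
    0<A = n≢0⇒n>0 λ A≡0 → <⇒≢ (m<n⇒0<n∸m 1<p) (trans (cong (_* H) (sym A≡0)) A-exact)

  excess-of-triple : ∀ {A B C} h → .{{NonZero h}} → 0 < A → A < B → B < C → e₃ A B C ∣ h * e₂ A B C + e₁ A B C →
                     Excess A ((A * h + 1) * (B * h + 1) * (C * h + 1))
  excess-of-triple {A} h 0<A A<B B<C (divides k S≡)
    with a , refl ← m≤n⇒∃[o]m+o≡n (<⇒≤ A<B)
    with b , refl ← m≤n⇒∃[o]m+o≡n (<⇒≤ B<C) = go k (sym S≡)
    where
    instance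
      A≢0 : NonZero A
      A≢0 = >-nonZero 0<A
      a≢0 : NonZero a
      a≢0 = >-nonZero (+-cancelˡ-< A 0 a (subst (_< A + a) (sym (+-identityʳ A)) A<B))
      b≢0 : NonZero b
      b≢0 = >-nonZero (+-cancelˡ-< (A + a) 0 b (subst (_< A + a + b) (sym (+-identityʳ (A + a))) B<C))
    open Triple A a b using (S₁; S₂; S₃; 1≤k)
    go : ∀ k → k * S₃ ≡ h * S₂ + S₁ → Excess A ((A * h + 1) * ((A + a) * h + 1) * ((A + a + b) * h + 1))
    go zero          eq = contradiction (1≤k h 0 eq) λ ()
    go (suc zero)    eq = excess-k≡1 A a b h eq
    go (suc (suc k)) eq = excess-k≥2 A a b h (suc (suc k)) eq (s≤s (s≤s z≤n))

  korselt-excess : ∀ {n} (K : K₃N n) → Excess (K₃N.A K) n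
  korselt-excess K = subst (Excess _) (sym n≡) (excess-of-triple (K₃N.H K) {{K₃N.H≢0 K}} 0<A A<B B<C S₃∣S)
    where open KorseltTriple K

  -- Integer bounds for the numerators of the root approximations.

  ^-cancelˡ-≤ : ∀ k .{{_ : NonZero k}} {a b} → a ^ k ≤ b ^ k → a ≤ b
  ^-cancelˡ-≤ k h = ≮⇒≥ λ b<a → <⇒≱ (^-monoˡ-< k b<a) h

  module _ (k : ℕ) .{{_ : NonZero k}} (n : ℕ) .{{_ : NonZero n}} (m : ℕ) where

    1+m≤rootNum : suc m ≤ rootNum k n m
    1+m≤rootNum = s≤s⁻¹ (^-cancelˡ-< k (≤-<-trans (m≤n*m (suc m ^ k) n) (proj₂ (iroot-spec k (n * suc m ^ k)))))

    rootNum≤ : rootNum k n m ≤ n * suc m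
    rootNum≤ = ^-cancelˡ-≤ k (begin
      rootNum k n m ^ k   ≤⟨ proj₁ (iroot-spec k (n * suc m ^ k)) ⟩
      n * suc m ^ k
        ≤⟨ *-monoˡ-≤ (suc m ^ k) (subst (_≤ n ^ k) (*-identityʳ n) (^-monoʳ-≤ n (>-nonZero⁻¹ k))) ⟩
      n ^ k * suc m ^ k   ≡⟨ sym (^-distribʳ-* k n (suc m)) ⟩
      (n * suc m) ^ k     ∎)

    -- For x ≥ M = m + 1 we have (x + 1) / M ≤ (x / M) (1 + 1 / M), so that multiplying
    -- an approximation from below by 1 + 1 / M yields one from above.
    rootNum-upper : n * (suc m * suc m) ^ k < (rootNum k n m * (2 + m)) ^ k
    rootNum-upper = begin-strict
      n * (M * M) ^ k       ≡⟨ cong (n *_) (^-distribʳ-* k M M) ⟩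
      n * (M ^ k * M ^ k)   ≡⟨ sym (*-assoc n (M ^ k) (M ^ k)) ⟩
      n * M ^ k * M ^ k     <⟨ *-monoˡ-< (M ^ k) {{m^n≢0 M k}} (proj₂ (iroot-spec k (n * M ^ k))) ⟩
      suc x ^ k * M ^ k     ≡⟨ sym (^-distribʳ-* k (suc x) M) ⟩
      (M + x * M) ^ k       ≤⟨ ^-monoˡ-≤ k (+-monoˡ-≤ (x * M) 1+m≤rootNum) ⟩
      (x + x * M) ^ k       ≡⟨ cong (_^ k) (sym (*-suc x M)) ⟩
      (x * suc M) ^ k       ∎
      where
      M = suc m
      x = rootNum k n m

  module Numerators (n : ℕ) .{{_ : NonZero n}} (m : ℕ) where

    M R a b d e : ℕ
    M = 1 + m
    R = 2 + m
    a = rootNum 2 3 m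
    b = rootNum 6 n m
    d = rootNum 12 n m
    e = rootNum 4 12 m

    -- The square of the twelfth root is the sixth root, up to one rounding factor `R / M`.
    d²≤bR : d * d ≤ b * R
    d²≤bR = ^-cancelˡ-≤ 6 (begin
      (d * d) ^ 6         ≡⟨ solve 1 (λ d → (d :* d) :^ 6 := d :^ 12) refl d ⟩
      d ^ 12              ≤⟨ proj₁ (iroot-spec 12 (n * M ^ 12)) ⟩
      n * M ^ 12          ≡⟨ solve 2 (λ n M → n :* M :^ 12 := n :* (M :* M) :^ 6) refl n M ⟩
      n * (M * M) ^ 6     ≤⟨ <⇒≤ (rootNum-upper 6 n m) ⟩
      (b * R) ^ 6         ∎)

    -- This approximates (⁴√12)² √3 = 6, which makes the square of 1 / (2 ⁴√12) equal to √3 / 24.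
    6M⁶≤e²aR³ : 6 * (M * M) ^ 3 ≤ (e * R) ^ 2 * (a * R)
    6M⁶≤e²aR³ = ^-cancelˡ-≤ 2 (begin
      (6 * (M * M) ^ 3) ^ 2
        ≡⟨ solve 1 (λ M → (con 6 :* (M :* M) :^ 3) :^ 2 :=
            con 12 :* (M :* M) :^ 4 :* (con 3 :* (M :* M) :^ 2)) refl M ⟩
      12 * (M * M) ^ 4 * (3 * (M * M) ^ 2)
        ≤⟨ *-mono-≤ (<⇒≤ (rootNum-upper 4 12 m)) (<⇒≤ (rootNum-upper 2 3 m)) ⟩
      (e * R) ^ 4 * (a * R) ^ 2
        ≡⟨ solve 2 (λ x y → x :^ 4 :* y :^ 2 := (x :^ 2 :* y) :^ 2) refl (e * R) (a * R) ⟩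
      ((e * R) ^ 2 * (a * R)) ^ 2               ∎)

    -- Since 27 = (√3)⁶, the hypothesis says N ≤ c √3 n^(1/6); each of the two roots costs one
    -- factor `R / M`.
    NM⁴≤cabR² : ∀ c N → N ^ 6 ≤ 27 * c ^ 6 * n → N * (M * M) ^ 2 ≤ c * ((a * R) * (b * R))
    NM⁴≤cabR² c N N⁶≤ = ^-cancelˡ-≤ 6 (begin
      (N * (M * M) ^ 2) ^ 6
        ≡⟨ solve 2 (λ N q → (N :* q :^ 2) :^ 6 := N :^ 6 :* q :^ 12) refl N (M * M) ⟩
      N ^ 6 * (M * M) ^ 12                                   ≤⟨ *-monoˡ-≤ ((M * M) ^ 12) N⁶≤ ⟩
      27 * c ^ 6 * n * (M * M) ^ 12
        ≡⟨ solve 3 (λ c n q → con 27 :* c :^ 6 :* n :* q :^ 12 :=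
            c :^ 6 :* ((con 3 :* q :^ 2) :^ 3 :* (n :* q :^ 6))) refl c n (M * M) ⟩
      c ^ 6 * ((3 * (M * M) ^ 2) ^ 3 * (n * (M * M) ^ 6))
        ≤⟨ *-monoʳ-≤ (c ^ 6) (*-mono-≤ (^-monoˡ-≤ 3 (<⇒≤ (rootNum-upper 2 3 m)))
            (<⇒≤ (rootNum-upper 6 n m))) ⟩
      c ^ 6 * (((a * R) ^ 2) ^ 3 * (b * R) ^ 6)
        ≡⟨ solve 3 (λ c x y → c :^ 6 :* ((x :^ 2) :^ 3 :* y :^ 6) :=
            (c :* (x :* y)) :^ 6) refl c (a * R) (b * R) ⟩
      (c * ((a * R) * (b * R))) ^ 6                          ∎)

module RationalEstimates where

  open NaturalEstimates
    using (rootNum≤; 1+m≤rootNum; module Numerators)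
  import Data.Nat.Solver as ℕSolver
  import Data.Integer.Base as ℤ
  open import Data.Rational.Base
  open import Data.Rational.Properties
  open import Data.Rational.Solver using (module +-*-Solver)
  open import Data.Sum.Base using (inj₁; inj₂)
  open +-*-Solver
  open ≤-Reasoning

  -- Rational arithmetic and the linearised inequality.

  ι : ℕ → ℚ
  ι x = ℤ.+ x / 1

  ι-suc : ∀ x → ι (suc x) ≡ ι x + 1ℚ
  ι-suc x = /-suc x 0

  ι-+ : ∀ x y → ι (x ℕ.+ y) ≡ ι x + ι y
  ι-+ zero    y = sym (+-identityˡ (ι y))
  ι-+ (suc x) y = begin-equality
    ι (suc (x ℕ.+ y))     ≡⟨ ι-suc (x ℕ.+ y) ⟩
    ι (x ℕ.+ y) + 1ℚ      ≡⟨ cong (_+ 1ℚ) (ι-+ x y) ⟩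
    ι x + ι y + 1ℚ        ≡⟨ solve 3 (λ x y z → x :+ y :+ z := x :+ z :+ y) refl (ι x) (ι y) 1ℚ ⟩
    ι x + 1ℚ + ι y        ≡⟨ cong (_+ ι y) (sym (ι-suc x)) ⟩
    ι (suc x) + ι y       ∎

  ι-* : ∀ x y → ι (x ℕ.* y) ≡ ι x * ι y
  ι-* zero    y = sym (*-zeroˡ (ι y))
  ι-* (suc x) y = begin-equality
    ι (y ℕ.+ x ℕ.* y)     ≡⟨ ι-+ y (x ℕ.* y) ⟩
    ι y + ι (x ℕ.* y)     ≡⟨ cong (ι y +_) (ι-* x y) ⟩
    ι y + ι x * ι y       ≡⟨ solve 2 (λ x y → y :+ x :* y := (x :+ con 1ℚ) :* y) refl (ι x) (ι y) ⟩
    (ι x + 1ℚ) * ι y      ≡⟨ cong (_* ι y) (sym (ι-suc x)) ⟩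
    ι (suc x) * ι y       ∎

  ι-mono : ∀ {x y} → x ℕ.≤ y → ι x ≤ ι y
  ι-mono {x} {y} x≤y = cross-≤ x y 0 0 (ℕ.*-monoˡ-≤ 1 x≤y)

  0≤ι : ∀ x → 0ℚ ≤ ι x
  0≤ι x = ι-mono (ℕ.z≤n {x})

  -- This pulls the common factor 1 / (m + 1) out of the normalised fractions, so that the ring
  -- solver can treat it as a variable.
  fraction : ∀ a m → ℤ.+ a / suc m ≡ ι a * (ℤ.+ 1 / suc m)
  fraction zero    m = trans (≤-antisym (cross-≤ 0 0 m 0 ℕ.≤-refl) (cross-≤ 0 0 0 m ℕ.≤-refl)) (sym (*-zeroˡ (ℤ.+ 1 / suc m)))
  fraction (suc a) m = begin-equality
    ℤ.+ suc a / suc m              ≡⟨ /-suc a m ⟩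
    ℤ.+ a / suc m + δ              ≡⟨ cong (_+ δ) (fraction a m) ⟩
    ι a * δ + δ                  ≡⟨ solve 2 (λ x d → x :* d :+ d := (x :+ con 1ℚ) :* d) refl (ι a) δ ⟩
    (ι a + 1ℚ) * δ               ≡⟨ cong (_* δ) (sym (ι-suc a)) ⟩
    ι (suc a) * δ                ∎
    where δ = ℤ.+ 1 / suc m

  ι-cancel : ∀ m → ι (suc m) * (ℤ.+ 1 / suc m) ≡ 1ℚ
  ι-cancel m = trans (sym (fraction (suc m) m))
    (≤-antisym (cross-≤ (suc m) 1 m 0 (ℕ.≤-reflexive (ℕ.*-comm (suc m) 1)))
               (cross-≤ 1 (suc m) 0 m (ℕ.≤-reflexive (ℕ.*-comm 1 (suc m)))))

  0≤* : ∀ {x y} → 0ℚ ≤ x → 0ℚ ≤ y → 0ℚ ≤ x * y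
  0≤* {x} {y} 0≤x 0≤y = subst (_≤ x * y) (*-zeroʳ x) (*-monoˡ-≤-nonNeg x {{nonNegative 0≤x}} 0≤y)

  0≤+ : ∀ {x y} → 0ℚ ≤ x → 0ℚ ≤ y → 0ℚ ≤ x + y
  0≤+ 0≤x 0≤y = +-mono-≤ 0≤x 0≤y

  0≤x² : ∀ x → 0ℚ ≤ x * x
  0≤x² x with ≤-total 0ℚ x
  ... | inj₁ 0≤x = 0≤* 0≤x 0≤x
  ... | inj₂ x≤0 = subst (0ℚ ≤_) (solve 1 (λ x → (:- x) :* (:- x) := x :* x) refl x)
                     (0≤* (neg-antimono-≤ x≤0) (neg-antimono-≤ x≤0))

  0≤- : ∀ {x y} → x ≤ y → 0ℚ ≤ y - x
  0≤- {x} {y} x≤y = subst (_≤ y - x) (+-inverseʳ x) (+-monoˡ-≤ (- x) x≤y)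

  ≤-from-difference : ∀ {x y} → 0ℚ ≤ y - x → x ≤ y
  ≤-from-difference {x} {y} h = subst₂ _≤_ (+-identityˡ x) (solve 2 (λ x y → y :- x :+ x := y) refl x y) (+-monoˡ-≤ x h)

  *-mono-nonNeg : ∀ {x y u v} → 0ℚ ≤ x → 0ℚ ≤ v → x ≤ y → u ≤ v → x * u ≤ y * v
  *-mono-nonNeg {x} {y} {u} {v} 0≤x 0≤v x≤y u≤v =
    ≤-trans (*-monoˡ-≤-nonNeg x {{nonNegative 0≤x}} u≤v) (*-monoʳ-≤-nonNeg v {{nonNegative 0≤v}} x≤y)

  -- This is 2 w y ≤ y² + w² for w = W / c, cleared of denominators.
  linearise : ∀ W c n A P y δ → 0ℚ ≤ c → c ≤ ι 48 * W →
              ι 24 * (y * y) ≤ P + ι 45 * n * δ →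
              c * A + W ≤ c * P + ι 9 * c * n * δ →
              1ℚ + c * (c * A + W) ≤ ι 24 * (W * W) →
              (ι 864 * W * c * n + ι 72 * c * c * n) * δ ≤ 1ℚ →
              1ℚ ≤ ι 96 * W * c * (P - A - y)
  linearise W c n A P y δ 0≤c c≤48W y²≤ N≤ small δ≤ = ≤-from-difference (subst (0ℚ ≤_) (identity W c n A P y δ)
    (0≤+ (0≤+ (0≤+ (0≤+ (0≤* (0≤ι 48) (0≤x² (c * y - W)))
                        (0≤* (0≤* (0≤ι 2) (0≤* 0≤c 0≤c)) (0≤- y²≤)))
                   (0≤* (0≤* (0≤ι 2) (0≤- c≤48W)) (0≤- N≤)))
              (0≤* (0≤ι 2) (0≤- small)))
         (0≤- δ≤)))
    where
    -- A certificate: a square plus the slack of each remaining hypothesis times a non-negative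
    -- coefficient. The coefficient `48 W - c` reflects that `P - P / (48 w)` must not decrease in
    -- `P`. The numbers 864 = 96 · 9 and 72 = 90 - 18 make the terms in `δ` cancel.
    identity : ∀ W c n A P y δ →
      ι 48 * ((c * y - W) * (c * y - W)) + ι 2 * (c * c) * (P + ι 45 * n * δ - ι 24 * (y * y))
        + ι 2 * (ι 48 * W - c) * (c * P + ι 9 * c * n * δ - (c * A + W))
        + ι 2 * (ι 24 * (W * W) - (1ℚ + c * (c * A + W)))
        + (1ℚ - (ι 864 * W * c * n + ι 72 * c * c * n) * δ)
      ≡ ι 96 * W * c * (P - A - y) - 1ℚ
    identity = solve 7 (λ W c n A P y δ →
      con (ι 48) :* ((c :* y :- W) :* (c :* y :- W)) :+ con (ι 2) :* (c :* c) :* (P :+ con (ι 45) :* n :* δ :- con (ι 24) :* (y :* y))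
        :+ con (ι 2) :* (con (ι 48) :* W :- c) :* (c :* P :+ con (ι 9) :* c :* n :* δ :- (c :* A :+ W))
        :+ con (ι 2) :* (con (ι 24) :* (W :* W) :- (con 1ℚ :+ c :* (c :* A :+ W)))
        :+ (con 1ℚ :- (con (ι 864) :* W :* c :* n :+ con (ι 72) :* c :* c :* n) :* δ)
      := con (ι 96) :* W :* c :* (P :- A :- y) :- con 1ℚ) refl

  -- The m-th rational approximations and their error bounds.

  module Approximants (n : ℕ) .{{_ : ℕ.NonZero n}} (m : ℕ) where
    open Numerators n m

    -- `s`, `g`, `t`, `f` approximate √3, n^(1/6), n^(1/12), ⁴√12; thus `P` approximates G and `y`
    -- approximates √(G / 24). `ρ` is the rounding factor `R / M`. The factor `ι 1` in `y` mirrors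
    -- the numerator `fromℕ 1` of the quotient of reals.
    δ ρ s g t f i y P : ℚ
    δ = ℤ.+ 1 / suc m
    ρ = 1ℚ + δ
    s = ι a * δ
    g = ι b * δ
    t = ι d * δ
    f = ι e * δ
    i = inv (ι 2 * f)
    y = ι 1 * i * t
    P = s * g

    Mδ≡1 : ι M * δ ≡ 1ℚ
    Mδ≡1 = ι-cancel m

    Rδ≡ρ : ι R * δ ≡ ρ
    Rδ≡ρ = begin-equality
      ι R * δ             ≡⟨ cong (_* δ) (ι-suc M) ⟩
      (ι M + 1ℚ) * δ      ≡⟨ solve 2 (λ x d → (x :+ con 1ℚ) :* d := x :* d :+ d) refl (ι M) δ ⟩
      ι M * δ + δ         ≡⟨ cong (_+ δ) Mδ≡1 ⟩
      1ℚ + δ              ∎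

    0<δ : 0ℚ < δ
    0<δ = cross-< 0 1 0 m (ℕ.s≤s ℕ.z≤n)

    0≤δ : 0ℚ ≤ δ
    0≤δ = <⇒≤ 0<δ

    δ≤1 : δ ≤ 1ℚ
    δ≤1 = cross-≤ 1 1 m 0 (ℕ.s≤s ℕ.z≤n)

    0≤ρ : 0ℚ ≤ ρ
    0≤ρ = 0≤+ (0≤ι 1) 0≤δ

    0≤numerator : ∀ x → 0ℚ ≤ ι x * δ
    0≤numerator x = 0≤* (0≤ι x) 0≤δ

    0≤s : 0ℚ ≤ s
    0≤s = 0≤numerator a

    0≤g : 0ℚ ≤ g
    0≤g = 0≤numerator b

    0≤P : 0ℚ ≤ P
    0≤P = 0≤* 0≤s 0≤g

    *δ-mono : ∀ {x y} → x ℕ.≤ y → ι x * δ ≤ ι y * δ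
    *δ-mono x≤y = *-monoʳ-≤-nonNeg δ {{nonNegative 0≤δ}} (ι-mono x≤y)

    numerator≤ : ∀ {x} k → x ℕ.≤ k ℕ.* M → ι x * δ ≤ ι k
    numerator≤ {x} k x≤kM = begin
      ι x * δ             ≤⟨ *δ-mono x≤kM ⟩
      ι (k ℕ.* M) * δ     ≡⟨ cong (_* δ) (ι-* k M) ⟩
      ι k * ι M * δ       ≡⟨ *-assoc (ι k) (ι M) δ ⟩
      ι k * (ι M * δ)     ≡⟨ cong (ι k *_) Mδ≡1 ⟩
      ι k * 1ℚ            ≡⟨ *-identityʳ (ι k) ⟩
      ι k                 ∎

    P≤3n : P ≤ ι 3 * ι n
    P≤3n = *-mono-nonNeg 0≤s (0≤ι n) (numerator≤ 3 (rootNum≤ 2 3 m)) (numerator≤ n (rootNum≤ 6 n m))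

    -- Positivity at every index rules out the default value of `inv` at 0.
    0<2f : 0ℚ < ι 2 * f
    0<2f = 0<* (cross-< 0 2 0 0 (ℕ.s≤s ℕ.z≤n))
      (<-≤-trans (subst (0ℚ <_) (sym Mδ≡1) (cross-< 0 1 0 0 (ℕ.s≤s ℕ.z≤n))) (*δ-mono (1+m≤rootNum 4 12 m)))

    t²≤gρ : t * t ≤ g * ρ
    t²≤gρ = begin
      ι d * δ * (ι d * δ)   ≡⟨ solve 2 (λ x e → x :* e :* (x :* e) := x :* x :* (e :* e)) refl (ι d) δ ⟩
      ι d * ι d * (δ * δ)   ≡⟨ cong (_* (δ * δ)) (sym (ι-* d d)) ⟩
      ι (d ℕ.* d) * (δ * δ) ≤⟨ *-monoʳ-≤-nonNeg (δ * δ) {{nonNegative (0≤* 0≤δ 0≤δ)}} (ι-mono d²≤bR) ⟩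
      ι (b ℕ.* R) * (δ * δ) ≡⟨ cong (_* (δ * δ)) (ι-* b R) ⟩
      ι b * ι R * (δ * δ)
        ≡⟨ solve 3 (λ x y e → x :* y :* (e :* e) := x :* e :* (y :* e)) refl (ι b) (ι R) δ ⟩
      ι b * δ * (ι R * δ)   ≡⟨ cong (g *_) Rδ≡ρ ⟩
      g * ρ                 ∎

    -- Multiplication by δ⁶, matching the degree of `6M⁶≤e²aR³`; each numerator thereby receives one
    -- `δ`.
    scale : ℚ → ℚ
    scale x = x * (δ * δ) * (δ * δ) * (δ * δ)

    scale-mono : ∀ {x y} → x ℕ.≤ y → scale (ι x) ≤ scale (ι y)
    scale-mono x≤y = *-mono-δ² (*-mono-δ² (*-mono-δ² (ι-mono x≤y)))
      where
      *-mono-δ² : ∀ {x y} → x ≤ y → x * (δ * δ) ≤ y * (δ * δ)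
      *-mono-δ² = *-monoʳ-≤-nonNeg (δ * δ) {{nonNegative (0≤* 0≤δ 0≤δ)}}

    ι-^2 : ∀ x → ι (x ℕ.^ 2) ≡ ι x * ι x
    ι-^2 x = trans (cong ι (cong (x ℕ.*_) (ℕ.*-identityʳ x))) (ι-* x x)

    6≤f²sρ³ : ι 6 ≤ f * f * s * (ρ * ρ * ρ)
    6≤f²sρ³ = begin
      ι 6                                            ≡⟨ sym scale-lhs ⟩
      scale (ι (6 ℕ.* (M ℕ.* M) ℕ.^ 3))              ≤⟨ scale-mono 6M⁶≤e²aR³ ⟩
      scale (ι ((e ℕ.* R) ℕ.^ 2 ℕ.* (a ℕ.* R)))      ≡⟨ scale-rhs ⟩
      f * f * s * (ρ * ρ * ρ)                        ∎
      where
      ι-M⁶ : ι ((M ℕ.* M) ℕ.^ 3) ≡ ι M * ι M * (ι M * ι M * (ι M * ι M))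
      ι-M⁶ = trans (ι-* (M ℕ.* M) ((M ℕ.* M) ℕ.^ 2)) (cong₂ _*_ (ι-* M M)
        (trans (ι-^2 (M ℕ.* M)) (cong₂ _*_ (ι-* M M) (ι-* M M))))
      scale-lhs : scale (ι (6 ℕ.* (M ℕ.* M) ℕ.^ 3)) ≡ ι 6
      scale-lhs = begin-equality
        scale (ι (6 ℕ.* (M ℕ.* M) ℕ.^ 3))
          ≡⟨ cong scale (trans (ι-* 6 ((M ℕ.* M) ℕ.^ 3)) (cong (ι 6 *_) ι-M⁶)) ⟩
        scale (ι 6 * (ι M * ι M * (ι M * ι M * (ι M * ι M))))
          ≡⟨ solve 2 (λ x e → con (ι 6) :* (x :* x :* (x :* x :* (x :* x))) :* (e :* e) :* (e :* e) :* (e :* e) :=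
               con (ι 6) :* ((x :* e) :* (x :* e) :* ((x :* e) :* (x :* e)) :* ((x :* e) :* (x :* e)))) refl (ι M) δ ⟩
        ι 6 * (ι M * δ * (ι M * δ) * (ι M * δ * (ι M * δ)) * (ι M * δ * (ι M * δ)))
          ≡⟨ cong (λ z → ι 6 * (z * z * (z * z) * (z * z))) Mδ≡1 ⟩
        ι 6                                          ∎
      scale-rhs : scale (ι ((e ℕ.* R) ℕ.^ 2 ℕ.* (a ℕ.* R))) ≡ f * f * s * (ρ * ρ * ρ)
      scale-rhs = begin-equality
        scale (ι ((e ℕ.* R) ℕ.^ 2 ℕ.* (a ℕ.* R)))
          ≡⟨ cong scale (trans (ι-* ((e ℕ.* R) ℕ.^ 2) (a ℕ.* R)) (cong₂ _*_
               (trans (ι-^2 (e ℕ.* R)) (cong₂ _*_ (ι-* e R) (ι-* e R))) (ι-* a R))) ⟩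
        scale (ι e * ι R * (ι e * ι R) * (ι a * ι R))
          ≡⟨ solve 4 (λ x y z e → x :* y :* (x :* y) :* (z :* y) :* (e :* e) :* (e :* e) :* (e :* e) :=
               x :* e :* (x :* e) :* (z :* e) :* ((y :* e) :* (y :* e) :* (y :* e))) refl (ι e) (ι R) (ι a) δ ⟩
        f * f * s * (ι R * δ * (ι R * δ) * (ι R * δ))  ≡⟨ cong (λ z → f * f * s * (z * z * z)) Rδ≡ρ ⟩
        f * f * s * (ρ * ρ * ρ)                        ∎

    N≤cPρ² : ∀ c N → N ℕ.^ 6 ℕ.≤ 27 ℕ.* c ℕ.^ 6 ℕ.* n → ι N ≤ ι c * (P * (ρ * ρ))
    N≤cPρ² c N N⁶≤ = begin
      ι N
        ≡⟨ sym (trans (cong (λ z → ι N * (z * z * (z * z))) Mδ≡1) (*-identityʳ (ι N))) ⟩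
      ι N * (ι M * δ * (ι M * δ) * (ι M * δ * (ι M * δ)))
        ≡⟨ solve 3 (λ N x e → N :* ((x :* e) :* (x :* e) :* ((x :* e) :* (x :* e))) :=
             N :* (x :* x :* (x :* x)) :* (e :* e :* (e :* e))) refl (ι N) (ι M) δ ⟩
      ι N * (ι M * ι M * (ι M * ι M)) * δ⁴
        ≡⟨ cong (_* δ⁴) (sym (trans (ι-* N ((M ℕ.* M) ℕ.^ 2)) (cong (ι N *_)
             (trans (ι-^2 (M ℕ.* M)) (cong₂ _*_ (ι-* M M) (ι-* M M)))))) ⟩
      ι (N ℕ.* (M ℕ.* M) ℕ.^ 2) * δ⁴
        ≤⟨ *-monoʳ-≤-nonNeg δ⁴ {{nonNegative (0≤x² (δ * δ))}} (ι-mono (NM⁴≤cabR² c N N⁶≤)) ⟩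
      ι (c ℕ.* ((a ℕ.* R) ℕ.* (b ℕ.* R))) * δ⁴
        ≡⟨ cong (_* δ⁴) (trans (ι-* c _) (cong (ι c *_) (trans (ι-* (a ℕ.* R) (b ℕ.* R)) (cong₂ _*_ (ι-* a R) (ι-* b R))))) ⟩
      ι c * (ι a * ι R * (ι b * ι R)) * δ⁴
        ≡⟨ solve 5 (λ c x y r e → c :* (x :* r :* (y :* r)) :* (e :* e :* (e :* e)) :=
             c :* (x :* e :* (y :* e) :* ((r :* e) :* (r :* e)))) refl (ι c) (ι a) (ι b) (ι R) δ ⟩
      ι c * (P * (ι R * δ * (ι R * δ)))
        ≡⟨ cong (λ z → ι c * (P * (z * z))) Rδ≡ρ ⟩
      ι c * (P * (ρ * ρ)) ∎
      where δ⁴ = δ * δ * (δ * δ)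

    -- As `i` is the inverse of `2 f`, the left side is `6 / f²`.
    24i²≤sρ³ : ι 24 * (i * i) ≤ s * (ρ * ρ * ρ)
    24i²≤sρ³ = begin
      ι 24 * (i * i)
        ≡⟨ solve 1 (λ i → con (ι 24) :* (i :* i) := con (ι 6) :* (con (ι 4) :* (i :* i))) refl i ⟩
      ι 6 * (ι 4 * (i * i))
        ≤⟨ *-monoʳ-≤-nonNeg (ι 4 * (i * i)) {{nonNegative (0≤* (0≤ι 4) (0≤x² i))}} 6≤f²sρ³ ⟩
      f * f * s * (ρ * ρ * ρ) * (ι 4 * (i * i))
        ≡⟨ solve 4 (λ f s r i → f :* f :* s :* r :* (con (ι 4) :* (i :* i)) :=
            con (ι 2) :* f :* i :* (con (ι 2) :* f :* i) :* (s :* r)) refl f s (ρ * ρ * ρ) i ⟩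
      ι 2 * f * i * (ι 2 * f * i) * (s * (ρ * ρ * ρ))
        ≡⟨ cong (λ z → z * z * (s * (ρ * ρ * ρ))) (*-inv 0<2f) ⟩
      1ℚ * (s * (ρ * ρ * ρ))                                 ≡⟨ *-identityˡ (s * (ρ * ρ * ρ)) ⟩
      s * (ρ * ρ * ρ)                                        ∎

    24y²≤Pρ⁴ : ι 24 * (y * y) ≤ P * (ρ * ρ * ρ * ρ)
    24y²≤Pρ⁴ = begin
      ι 24 * (y * y)
        ≡⟨ solve 2 (λ i t → con (ι 24) :* (con (ι 1) :* i :* t :* (con (ι 1) :* i :* t)) :=
            con (ι 24) :* (i :* i) :* (t :* t)) refl i t ⟩
      ι 24 * (i * i) * (t * t)        ≤⟨ *-mono-nonNeg (0≤* (0≤ι 24) (0≤x² i)) (0≤* 0≤g 0≤ρ) 24i²≤sρ³ t²≤gρ ⟩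
      s * (ρ * ρ * ρ) * (g * ρ)
        ≡⟨ solve 3 (λ s g r → s :* (r :* r :* r) :* (g :* r) := s :* g :* (r :* r :* r :* r)) refl s g ρ ⟩
      P * (ρ * ρ * ρ * ρ)             ∎

    -- On 0 ≤ δ ≤ 1 a convex power of 1 + δ lies below its chord, whose slope is 2² - 1 = 3 here and
    -- 2⁴ - 1 = 15 in `ρ⁴≤`.
    ρ²≤ : ρ * ρ ≤ 1ℚ + ι 3 * δ
    ρ²≤ = ≤-from-difference (subst (0ℚ ≤_)
      (solve 1 (λ d → d :* (con 1ℚ :- d) := con 1ℚ :+ con (ι 3) :* d :- (con 1ℚ :+ d) :* (con 1ℚ :+ d)) refl δ)
      (0≤* 0≤δ (0≤- δ≤1)))

    ρ⁴≤ : ρ * ρ * ρ * ρ ≤ 1ℚ + ι 15 * δ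
    ρ⁴≤ = ≤-from-difference (subst (0ℚ ≤_)
      (solve 1 (λ d → d :* (con 1ℚ :- d) :* (d :* d :+ con (ι 5) :* d :+ con (ι 11)) :=
         con 1ℚ :+ con (ι 15) :* d :- (con 1ℚ :+ d) :* (con 1ℚ :+ d) :* (con 1ℚ :+ d) :* (con 1ℚ :+ d)) refl δ)
      (0≤* (0≤* 0≤δ (0≤- δ≤1)) (0≤+ (0≤+ (0≤x² δ) (0≤* (0≤ι 5) 0≤δ)) (0≤ι 11))))

    -- The crude bound `P≤3n` turns the relative error into an absolute one that is linear in `δ`.
    perturb : ∀ x k → 0ℚ ≤ k → x ≤ 1ℚ + k * δ → P * x ≤ P + k * (ι 3 * ι n) * δ
    perturb x k 0≤k x≤ = begin
      P * x                         ≤⟨ *-monoˡ-≤-nonNeg P {{nonNegative 0≤P}} x≤ ⟩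
      P * (1ℚ + k * δ)
        ≡⟨ solve 3 (λ P k d → P :* (con 1ℚ :+ k :* d) := P :+ k :* d :* P) refl P k δ ⟩
      P + k * δ * P
        ≤⟨ +-monoʳ-≤ P (*-monoˡ-≤-nonNeg (k * δ) {{nonNegative (0≤* 0≤k 0≤δ)}} P≤3n) ⟩
      P + k * δ * (ι 3 * ι n)
        ≡⟨ solve 4 (λ P k d n → P :+ k :* d :* n := P :+ k :* n :* d) refl P k δ (ι 3 * ι n) ⟩
      P + k * (ι 3 * ι n) * δ       ∎

    24y²≤ : ι 24 * (y * y) ≤ P + ι 45 * ι n * δ
    24y²≤ = ≤-trans 24y²≤Pρ⁴ (≤-trans (perturb _ (ι 15) (0≤ι 15) ρ⁴≤)
      (≤-reflexive (solve 3 (λ P n d → P :+ con (ι 15) :* (con (ι 3) :* n) :* d := P :+ con (ι 45) :* n :* d) refl P (ι n) δ)))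

    N≤ : ∀ c N → N ℕ.^ 6 ℕ.≤ 27 ℕ.* c ℕ.^ 6 ℕ.* n → ι N ≤ ι c * P + ι 9 * ι c * ι n * δ
    N≤ c N N⁶≤ = ≤-trans (N≤cPρ² c N N⁶≤) (≤-trans
      (*-monoˡ-≤-nonNeg (ι c) {{nonNegative (0≤ι c)}} (perturb _ (ι 3) (0≤ι 3) ρ²≤))
      (≤-reflexive (solve 4 (λ c P n d → c :* (P :+ con (ι 3) :* (con (ι 3) :* n) :* d) := c :* P :+ con (ι 9) :* c :* n :* d)
        refl (ι c) P (ι n) δ)))

  -- A uniform positive gap at all late indices.

  module Separation (n A c W : ℕ) .{{_ : ℕ.NonZero n}}
                    (small : c ℕ.* (c ℕ.* A ℕ.+ W) ℕ.< 24 ℕ.* W ℕ.^ 2)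
                    (power : (c ℕ.* A ℕ.+ W) ℕ.^ 6 ℕ.≤ 27 ℕ.* c ℕ.^ 6 ℕ.* n) where

    0<W : 0 ℕ.< W
    0<W = ℕ.n≢0⇒n>0 λ { refl → ℕ.n≮0 small }

    0<c : 0 ℕ.< c
    -- With c = 0 the hypothesis `power` would read `W⁶ ≤ 0`.
    0<c = ℕ.n≢0⇒n>0 λ { refl → ℕ.<⇒≱ (ℕ.>-nonZero⁻¹ (W ℕ.^ 6) {{ℕ.m^n≢0 W 6 {{ℕ.>-nonZero 0<W}}}}) power }

    c≤24W : c ℕ.≤ 24 ℕ.* W
    c≤24W = ℕ.*-cancelʳ-≤ c (24 ℕ.* W) W {{ℕ.>-nonZero 0<W}} (R.begin
      c ℕ.* W                     R.≤⟨ ℕ.*-monoʳ-≤ c (ℕ.m≤n+m W (c ℕ.* A)) ⟩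
      c ℕ.* (c ℕ.* A ℕ.+ W)       R.≤⟨ ℕ.<⇒≤ small ⟩
      24 ℕ.* W ℕ.^ 2              R.≡⟨ N.solve 1 (λ W → N.con 24 N.:* W N.:^ 2 N.:= N.con 24 N.:* W N.:* W) refl W ⟩
      24 ℕ.* W ℕ.* W              R.∎)
      where
      module R = ℕ.≤-Reasoning
      module N = ℕSolver.+-*-Solver

    ι-N : ι (c ℕ.* A ℕ.+ W) ≡ ι c * ι A + ι W
    ι-N = trans (ι-+ (c ℕ.* A) W) (cong (_+ ι W) (ι-* c A))

    ι-small : 1ℚ + ι c * (ι c * ι A + ι W) ≤ ι 24 * (ι W * ι W)
    ι-small = subst₂ _≤_
      (trans (ι-+ 1 (c ℕ.* (c ℕ.* A ℕ.+ W))) (cong (1ℚ +_) (trans (ι-* c _) (cong (ι c *_) ι-N))))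
      (trans (ι-* 24 (W ℕ.^ 2)) (cong (ι 24 *_) (trans (ι-* W (W ℕ.* 1)) (cong (λ x → ι W * ι x) (ℕ.*-identityʳ W)))))
      (ι-mono small)

    ι-c≤48W : ι c ≤ ι 48 * ι W
    ι-c≤48W = subst (ι c ≤_) (ι-* 48 W) (ι-mono (ℕ.≤-trans c≤24W (ℕ.*-monoˡ-≤ W (ℕ.m≤m+n 24 24))))

    -- From this index on, `δ` is small enough for the last hypothesis of `linearise`.
    threshold : ℕ
    threshold = 864 ℕ.* W ℕ.* c ℕ.* n ℕ.+ 72 ℕ.* c ℕ.* c ℕ.* n

    ι-threshold : ι threshold ≡ ι 864 * ι W * ι c * ι n + ι 72 * ι c * ι c * ι n
    ι-threshold = trans (ι-+ (864 ℕ.* W ℕ.* c ℕ.* n) (72 ℕ.* c ℕ.* c ℕ.* n)) (cong₂ _+_ (ι-*⁴ 864 W c n) (ι-*⁴ 72 c c n))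
      where
      ι-*⁴ : ∀ w x y z → ι (w ℕ.* x ℕ.* y ℕ.* z) ≡ ι w * ι x * ι y * ι z
      ι-*⁴ w x y z = trans (ι-* (w ℕ.* x ℕ.* y) z) (cong (_* ι z) (trans (ι-* (w ℕ.* x) y) (cong (_* ι y) (ι-* w x))))

    X : ℚ
    X = ι 96 * ι W * ι c

    0<X : 0ℚ < X
    0<X = 0<* (0<* (cross-< 0 96 0 0 (ℕ.s≤s ℕ.z≤n)) (0<ι 0<W)) (0<ι 0<c)
      where
      0<ι : ∀ {x} → 0 ℕ.< x → 0ℚ < ι x
      0<ι {x} 0<x = cross-< 0 x 0 0 (ℕ.*-monoˡ-< 1 0<x)

    gap-bound : ∀ m → threshold ℕ.≤ m → let open Approximants n m in 1ℚ ≤ X * (P - ι A - y)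
    gap-bound m t≤m = linearise (ι W) (ι c) (ι n) (ι A) P y δ (0≤ι c) ι-c≤48W 24y²≤
      (subst (_≤ ι c * P + ι 9 * ι c * ι n * δ) ι-N (N≤ c (c ℕ.* A ℕ.+ W) power)) ι-small
      (subst (λ x → x * δ ≤ 1ℚ) ι-threshold (numerator≤ 1 (ℕ.≤-trans (ℕ.≤-trans t≤m (ℕ.n≤1+n m)) (ℕ.≤-reflexive (sym (ℕ.*-identityˡ (suc m)))))))
      where open Approximants n m

    separation : fromℕ A <ᴿ root 2 3 *ᴿ root 6 n -ᴿ (fromℕ 1 /ᴿ (fromℕ 2 *ᴿ root 4 12) [ 0<2*⁴√12 ]) *ᴿ root 12 n
    separation =
      -- The gap is ε = 1 / (96 W c), independent of the index.
      let ε , 0<ε , Xε≡1 = quot 0<X (cross-< 0 1 0 0 (ℕ.s≤s ℕ.z≤n)) in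
      ε , 0<ε , threshold , λ m t≤m → below m t≤m ε Xε≡1
      where
      terms : ∀ m → seq (root 2 3 *ᴿ root 6 n -ᴿ (fromℕ 1 /ᴿ (fromℕ 2 *ᴿ root 4 12) [ 0<2*⁴√12 ]) *ᴿ root 12 n) m ≡
                    (let open Approximants n m in P - y)
      terms m = cong₂ (λ x y → x + - y)
        (cong₂ _*_ (fraction (rootNum 2 3 m) m) (fraction (rootNum 6 n m) m))
        (cong₂ (λ f t → ι 1 * inv (ι 2 * f) * t) (fraction (rootNum 4 12 m) m) (fraction (rootNum 12 n m) m))
      below : ∀ m → threshold ℕ.≤ m → ∀ ε → X * ε ≡ 1ℚ →
              ι A + ε ≤ seq (root 2 3 *ᴿ root 6 n -ᴿ (fromℕ 1 /ᴿ (fromℕ 2 *ᴿ root 4 12) [ 0<2*⁴√12 ]) *ᴿ root 12 n) m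
      below m t≤m ε Xε≡1 = begin
        ι A + ε
          ≤⟨ +-monoʳ-≤ (ι A) (*-cancelˡ-≤-pos X {{positive 0<X}} (subst (_≤ X * (P - ι A - y)) (sym Xε≡1) (gap-bound m t≤m))) ⟩
        ι A + (P - ι A - y)       ≡⟨ solve 3 (λ A P y → A :+ (P :- A :- y) := P :- y) refl (ι A) P y ⟩
        P - y                     ≡⟨ sym (terms m) ⟩
        seq (root 2 3 *ᴿ root 6 n -ᴿ (fromℕ 1 /ᴿ (fromℕ 2 *ᴿ root 4 12) [ 0<2*⁴√12 ]) *ᴿ root 12 n) m ∎
        where open Approximants n m

korselt-nonZero : ∀ {n} → K₃N n → ℕ.NonZero n
korselt-nonZero K = subst ℕ.NonZero (sym n≡pqr) (ℕ.>-nonZero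
  (ℕ.*-mono-≤ (ℕ.*-mono-≤ 1≤p 1≤q) (ℕ.≤-trans 1≤q (ℕ.<⇒≤ q<r))))
  where
  open K₃N K
  1≤p = ℕ.<⇒≤ 1<p
  1≤q = ℕ.≤-trans 1≤p (ℕ.<⇒≤ p<q)

theorem4p7 : ∀ (n : ℕ) (K : K₃N n) →
    fromℕ (K₃N.A K) <ᴿ root 2 3 *ᴿ root 6 n -ᴿ (fromℕ 1 /ᴿ (fromℕ 2 *ᴿ root 4 12) [ 0<2*⁴√12 ]) *ᴿ root 12 n
theorem4p7 n K = let c , W , small , power = NaturalEstimates.korselt-excess K in
  RationalEstimates.Separation.separation n (K₃N.A K) c W {{korselt-nonZero K}} small power
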